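{- The problem Coloured Clustering on edge-coloured graphs, parameterized by the number $k$ of stable edges, can be solved in FPT time; that is, there is a deterministic algorithm which, given an edge-coloured graph $G$ and a positive integer $k$, decides whether there is a vertex colouring of $G$ that produces at least $k$ stable edges, in time $g(k)\cdot |G|^{O(1)}$ for some computable function $g$ depending only on $k$, where $|G|$ denotes the input size.
   Context: An edge-coloured graph $G$ is a finite simple undirected graph in which each edge $e$ has a unique colour $\psi(e)\in\{1,\dots,t\}$ for some positive integer $t$ (not required to be a proper edge colouring; $t$ is part of the input and not bounded). A vertex colouring $f$ assigns to each vertex $v$ a colour $f(v)\in\{1,\dots,t\}$ (not required to be proper); an edge $uv$ is stable under $f$ if $\psi(uv)=f(u)=f(v)$. -}

module Defs where

open import Data.Fin.Base using (Fin; toℕ)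
import Data.Fin.Properties as Fin
open import Data.List.Base
  using (List; []; _∷_; map; mapMaybe; filter; length; allFin; cartesianProduct)
open import Data.Maybe.Base as Maybe using (Maybe; nothing)
open import Data.Nat.Base using (ℕ; zero; suc; _+_; _*_; _^_; _≤_; _<_)
open import Data.Nat.Binary.Base using (ℕᵇ; 2[1+_]; 1+[2_]; fromℕ)
import Data.Nat.Binary.Base as ℕᵇ
open import Data.Product.Base using (_×_; _,_; ∃-syntax; Σ-syntax)
open import Data.Vec.Base using (Vec; []; _∷_; lookup)
open import Function.Bundles using (_⇔_)
open import Relation.Binary.PropositionalEquality using (_≡_; _≢_; refl)
open import Relation.Nullary.Decidable using (Dec; _×-dec_)

------------------------------------------------------------------------
-- Model of computation
--
-- Programs are finite systems of mutually recursive first-order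
-- functions over binary trees (pure first-order LISP; cf. the languages
-- WHILE and F of N. D. Jones, "Computability and Complexity").  Running
-- time is the number of evaluation steps.  Each step is a constant
-- number of pointer operations on a heap of shared cells, and there is
-- no primitive arithmetic and no primitive comparison of trees, so
-- running times agree with those of deterministic Turing machines up to
-- a polynomial.

infixr 5 _∙_

data Tree : Set where
  leaf : Tree
  _∙_  : Tree → Tree → Tree

size : Tree → ℕ
size leaf    = 1
size (x ∙ y) = suc (size x + size y)

-- Expressions over m function names with n variables in scope
-- (de Bruijn indices, most recently bound variable first).

data Exp (m : ℕ) : ℕ → Set where
  var     : ∀ {n} → Fin n → Exp m n
  leaf    : ∀ {n} → Exp m n
  cons    : ∀ {n} → Exp m n → Exp m n → Exp m n
  case    : ∀ {n} → Exp m n → Exp m n → Exp m (suc (suc n)) → Exp m n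
  letting : ∀ {n} → Exp m n → Exp m (suc n) → Exp m n
  call    : ∀ {n} → Fin m → Exp m n → Exp m n

record Program : Set where
  constructor program
  field
    {count}   : ℕ
    functions : Vec (Exp count 1) count
    main      : Exp count 1

-- fs ∣ ρ ⊢ e ⇓ v ⟨ s ⟩ : with function bodies fs and variable values ρ,
-- the expression e evaluates to v in s steps.

infix 3 _∣_⊢_⇓_⟨_⟩

data _∣_⊢_⇓_⟨_⟩ {m : ℕ} (fs : Vec (Exp m 1) m) :
       ∀ {n} → Vec Tree n → Exp m n → Tree → ℕ → Set where

  ⇓var : ∀ {n} {ρ : Vec Tree n} {i} →
    fs ∣ ρ ⊢ var i ⇓ lookup ρ i ⟨ 1 ⟩

  ⇓leaf : ∀ {n} {ρ : Vec Tree n} →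
    fs ∣ ρ ⊢ leaf ⇓ leaf ⟨ 1 ⟩

  ⇓cons : ∀ {n} {ρ : Vec Tree n} {d e x y s t} →
    fs ∣ ρ ⊢ d ⇓ x ⟨ s ⟩ →
    fs ∣ ρ ⊢ e ⇓ y ⟨ t ⟩ →
    fs ∣ ρ ⊢ cons d e ⇓ x ∙ y ⟨ suc (s + t) ⟩

  ⇓case-leaf : ∀ {n} {ρ : Vec Tree n} {e d₁ d₂ v s t} →
    fs ∣ ρ ⊢ e ⇓ leaf ⟨ s ⟩ →
    fs ∣ ρ ⊢ d₁ ⇓ v ⟨ t ⟩ →
    fs ∣ ρ ⊢ case e d₁ d₂ ⇓ v ⟨ suc (s + t) ⟩

  ⇓case-node : ∀ {n} {ρ : Vec Tree n} {e d₁ d₂ x y v s t} →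
    fs ∣ ρ ⊢ e ⇓ x ∙ y ⟨ s ⟩ →
    fs ∣ x ∷ y ∷ ρ ⊢ d₂ ⇓ v ⟨ t ⟩ →
    fs ∣ ρ ⊢ case e d₁ d₂ ⇓ v ⟨ suc (s + t) ⟩

  ⇓letting : ∀ {n} {ρ : Vec Tree n} {d e x v s t} →
    fs ∣ ρ ⊢ d ⇓ x ⟨ s ⟩ →
    fs ∣ x ∷ ρ ⊢ e ⇓ v ⟨ t ⟩ →
    fs ∣ ρ ⊢ letting d e ⇓ v ⟨ suc (s + t) ⟩

  ⇓call : ∀ {n} {ρ : Vec Tree n} {f e x v s t} →
    fs ∣ ρ ⊢ e ⇓ x ⟨ s ⟩ →
    fs ∣ x ∷ [] ⊢ lookup fs f ⇓ v ⟨ t ⟩ →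
    fs ∣ ρ ⊢ call f e ⇓ v ⟨ suc (s + t) ⟩

⇓-deterministic : ∀ {m} {fs : Vec (Exp m 1) m} {n} {ρ : Vec Tree n} {e v w s t} →
  fs ∣ ρ ⊢ e ⇓ v ⟨ s ⟩ → fs ∣ ρ ⊢ e ⇓ w ⟨ t ⟩ → v ≡ w × s ≡ t
⇓-deterministic ⇓var  ⇓var  = refl , refl
⇓-deterministic ⇓leaf ⇓leaf = refl , refl
⇓-deterministic (⇓cons p q) (⇓cons p′ q′)
  with refl , refl ← ⇓-deterministic p p′
  with refl , refl ← ⇓-deterministic q q′ = refl , refl
⇓-deterministic (⇓case-leaf p q) (⇓case-leaf p′ q′)
  with refl , refl ← ⇓-deterministic p p′
  with refl , refl ← ⇓-deterministic q q′ = refl , refl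
⇓-deterministic (⇓case-leaf p q) (⇓case-node p′ q′)
  with () , _ ← ⇓-deterministic p p′
⇓-deterministic (⇓case-node p q) (⇓case-leaf p′ q′)
  with () , _ ← ⇓-deterministic p p′
⇓-deterministic (⇓case-node p q) (⇓case-node p′ q′)
  with refl , refl ← ⇓-deterministic p p′
  with refl , refl ← ⇓-deterministic q q′ = refl , refl
⇓-deterministic (⇓letting p q) (⇓letting p′ q′)
  with refl , refl ← ⇓-deterministic p p′
  with refl , refl ← ⇓-deterministic q q′ = refl , refl
⇓-deterministic (⇓call p q) (⇓call p′ q′)
  with refl , refl ← ⇓-deterministic p p′
  with refl , refl ← ⇓-deterministic q q′ = refl , refl

_on_yields_within_ : Program → Tree → Tree → ℕ → Set
p on x yields y within b =
  ∃[ s ] (functions ∣ x ∷ [] ⊢ main ⇓ y ⟨ s ⟩) × s ≤ b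
  where open Program p

------------------------------------------------------------------------
-- Encodings

encodeUnary : ℕ → Tree
encodeUnary zero    = leaf
encodeUnary (suc k) = leaf ∙ encodeUnary k

encodeBits : ℕᵇ → Tree
encodeBits ℕᵇ.zero  = leaf
encodeBits 2[1+ b ] = leaf ∙ encodeBits b
encodeBits 1+[2 b ] = (leaf ∙ leaf) ∙ encodeBits b

encodeBinary : ℕ → Tree
encodeBinary n = encodeBits (fromℕ n)

encodeList : List Tree → Tree
encodeList []       = leaf
encodeList (x ∷ xs) = x ∙ encodeList xs

------------------------------------------------------------------------
-- Fixed-parameter tractability

record ParameterizedProblem : Set₁ where
  field
    Input  : Set
    encode : Input → Tree
    Yes    : Input → ℕ → Set

Computable : (ℕ → ℕ) → Set
Computable g =
  ∃[ p ] ∀ k → ∃[ b ] p on encodeUnary k yields encodeUnary (g k) within b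

-- The parameter ranges over the positive integers.  How it is written
-- on the input is immaterial, as conversion between encodings of k takes
-- time bounded by a computable function of k.  A program rejects by
-- returning leaf and accepts by returning any other tree.

FixedParameterTractable : ParameterizedProblem → Set
FixedParameterTractable P =
  ∃[ p ] ∃[ g ] ∃[ c ] Computable g ×
    (∀ (x : Input) (k : ℕ) → 0 < k →
       ∃[ y ] p on (encode x ∙ encodeUnary k) yields y
                within (g k * size (encode x) ^ c)
            × (y ≢ leaf ⇔ Yes x k))
  where open ParameterizedProblem P

------------------------------------------------------------------------
-- Edge-coloured graphs

-- The vertices are Fin n and the colours 1, …, t are represented by
-- Fin t.  The value ψ u v is just the colour of uv if uv is an edge, and
-- nothing if it is not.

record EdgeColouredGraph : Set where
  field
    n t         : ℕ
    t-positive  : 0 < t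
    ψ           : Fin n → Fin n → Maybe (Fin t)
    ψ-symmetric : ∀ u v → ψ u v ≡ ψ v u
    ψ-loopless  : ∀ v → ψ v v ≡ nothing

  -- Every edge occurs exactly once, as (u , v , colour) with u < v.
  edges : List (Fin n × Fin n × Fin t)
  edges = mapMaybe (λ (u , v) → Maybe.map (λ c → u , v , c) (ψ u v))
            (filter (λ (u , v) → u Fin.<? v)
              (cartesianProduct (allFin n) (allFin n)))

  VertexColouring : Set
  VertexColouring = Fin n → Fin t

  Stable : VertexColouring → Fin n × Fin n × Fin t → Set
  Stable f (u , v , c) = c ≡ f u × f u ≡ f v

  stable? : ∀ f e → Dec (Stable f e)
  stable? f (u , v , c) = (c Fin.≟ f u) ×-dec (f u Fin.≟ f v)

  stableEdges : VertexColouring → List (Fin n × Fin n × Fin t)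
  stableEdges f = filter (stable? f) edges

open EdgeColouredGraph using (VertexColouring; stableEdges)

-- The list of vertices, the number of colours, and the list of coloured
-- edges, with vertices and numbers written in binary.

encodeGraph : EdgeColouredGraph → Tree
encodeGraph G =
  encodeList (map vertex (allFin n)) ∙ encodeBinary t ∙ encodeList (map edge edges)
  where
  open EdgeColouredGraph G

  vertex : Fin n → Tree
  vertex v = encodeBinary (toℕ v)

  edge : Fin n × Fin n × Fin t → Tree
  edge (u , v , c) = vertex u ∙ vertex v ∙ encodeBinary (suc (toℕ c))

ColouredClustering : ParameterizedProblem
ColouredClustering = record
  { Input  = EdgeColouredGraph
  ; encode = encodeGraph
  ; Yes    = λ G k → Σ[ f ∈ VertexColouring G ] k ≤ length (stableEdges G f)
  }

{-# OPTIONS --safe #-}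
module Submission where

-- The algorithm is a greedy localisation.  Fix k slots, one for each colour
-- of a hypothetical solution with k stable edges, and keep a list of labels
-- (x , j): "vertex x may only be used by slot j".  Slot after slot, greedily
-- claim a largest set of edges of one colour whose endpoints carry no other
-- label, and label these endpoints.  If k edges are claimed, they are stable
-- under a common colouring.  Otherwise fewer than 2k vertices were labelled,
-- and if the labels given agree with a solution, then some slot of the
-- solution was beaten to one of these vertices; so some vertex of the
-- solution was labelled with the wrong slot and did not occur in the given
-- labels.  Branching over its right label gives a search tree of degree
-- O(k²) and of depth 2k, as a solution has at most 2k endpoints.

open import Defs

open import Data.Bool.Base using (Bool; T; true; false; _∧_; _∨_; not; if_then_else_)
open import Data.Bool.ListAction using (any)
open import Data.Fin.Base using (Fin; toℕ; fromℕ<)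
open import Data.Fin.Patterns
import Data.Fin.Properties as Fin
open import Data.List.Base using (List; []; _∷_; _++_; map; filter; length; concatMap; take)
import Data.List.Membership.DecPropositional as DecMembership
open import Data.List.Membership.Propositional using (_∈_; find)
open import Data.List.Membership.Propositional.Properties
  using (∈-filter⁺; ∈-filter⁻; ∈-map⁺; ∈-++⁻)
open import Data.List.Properties
  using (length-++; length-filter; length-map; length-take; filter-all; filter-none)
open import Data.List.Relation.Binary.Sublist.Propositional
  using (_⊆_; []; _∷_; _∷ʳ_; ⊆-refl; ⊆-trans; lookup)
open import Data.List.Relation.Binary.Sublist.Propositional.Properties using (take-⊆; filter-⊆)
open import Data.List.Relation.Unary.All as All using (All; []; _∷_; all?)
open import Data.List.Relation.Unary.All.Properties using (++⁻ʳ; ¬All⇒Any¬; all-filter; take⁺)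
open import Data.List.Relation.Unary.Any using (here; there)
open import Data.Nat.Base
open import Data.Nat.Binary.Base as ℕᵇ using (ℕᵇ; 2[1+_]; 1+[2_])
open import Data.Nat.Binary.Properties using (fromℕ-injective)
open import Data.Nat.ListAction using (sum)
open import Data.Nat.ListAction.Properties using (sum-++)
open import Data.Nat.Properties
open import Data.Nat.Tactic.RingSolver using (solve-∀)
open import Data.Product.Base using (_×_; _,_; proj₁; proj₂; ∃-syntax)
open import Data.Sum.Base using (_⊎_; inj₁; inj₂)
open import Data.Unit.Base using (tt)
open import Data.Vec.Base as Vec using (Vec; []; _∷_)
open import Function.Base using (_∘_; _$_)
open import Function.Bundles using (_⇔_; mk⇔; module Equivalence)
open import Function.Definitions using (Injective)
open import Level using (0ℓ)
open import Relation.Binary.Definitions using (DecidableEquality)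
open import Relation.Binary.PropositionalEquality
open import Relation.Nullary.Decidable
  using (Dec; does; yes; no; _×-dec_; _→-dec_; ¬?; decidable-stable; dec-true)
open import Relation.Nullary.Negation using (¬_; contradiction)
open import Relation.Nullary.Reflects using (ofʸ; ofⁿ)
open import Relation.Unary using (Pred; Decidable)

-- The number of colours is not bounded in `k`, so one cannot branch over the colour of a vertex. A
-- label therefore names one of `k` slots, and the colour of a slot is chosen afresh by the greedy
-- step at every node of the search tree. Labels only forbid claims: a positive answer is sound
-- whatever the labels are, and completeness has to follow just one branch of right guesses. Success
-- is read off the length of the label list, which grows by two entries per claimed edge,
-- repetitions included. When the test fails, this same length is below `4k`, so the degree of the
-- search tree does not depend on the graph. The running time then obeys a recurrence: work
-- polynomial in `k` and the input size at each node, and a factor depending on `k` alone per level.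

module _ {A : Set} {P Q : Pred A 0ℓ} (P? : Decidable P) (Q? : Decidable Q) where

  length-filter-mono : ∀ {xs ys} → xs ⊆ ys → (∀ {x} → x ∈ xs → P x → Q x) →
    length (filter P? xs) ≤ length (filter Q? ys)
  length-filter-mono [] P⇒Q = z≤n
  length-filter-mono (y ∷ʳ xs⊆ys) P⇒Q with ih ← length-filter-mono xs⊆ys P⇒Q | Q? y
  ... | yes _ = m≤n⇒m≤1+n ih
  ... | no  _ = ih
  length-filter-mono {x ∷ _} (refl ∷ xs⊆ys) P⇒Q
    with ih ← length-filter-mono xs⊆ys (P⇒Q ∘ there) | P? x | Q? x
  ... | yes p | yes q = s≤s ih
  ... | yes p | no ¬q = contradiction (P⇒Q (here refl) p) ¬q
  ... | no  _ | yes _ = m≤n⇒m≤1+n ih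
  ... | no  _ | no  _ = ih

  length-filter-strict : ∀ {x xs} → x ∈ xs → (∀ {y} → P y → Q y) → Q x → ¬ P x →
    length (filter P? xs) < length (filter Q? xs)
  length-filter-strict {x} {_ ∷ xs} (here refl) P⇒Q qx ¬px with P? x | Q? x
  ... | yes px | _      = contradiction px ¬px
  ... | no _   | no ¬qx = contradiction qx ¬qx
  ... | no _   | yes _  = s≤s (length-filter-mono (⊆-refl {x = xs}) (λ _ → P⇒Q))
  length-filter-strict {xs = y ∷ _} (there x∈xs) P⇒Q qx ¬px
    with ih ← length-filter-strict x∈xs P⇒Q qx ¬px | P? y | Q? y
  ... | yes py | no ¬qy = contradiction (P⇒Q py) ¬qy
  ... | yes _  | yes _  = s≤s ih
  ... | no _   | yes _  = m≤n⇒m≤1+n ih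
  ... | no _   | no _   = ih

  module _ {R : Pred A 0ℓ} (R? : Decidable R) where

    length-filter-⊎ : (∀ {x} → R x → P x ⊎ Q x) → ∀ xs →
      length (filter R? xs) ≤ length (filter P? xs) + length (filter Q? xs)
    length-filter-⊎ R⇒P⊎Q [] = z≤n
    length-filter-⊎ R⇒P⊎Q (x ∷ xs)
      with ih ← length-filter-⊎ R⇒P⊎Q xs | R? x | P? x | Q? x
    ... | yes _ | yes _ | no  _ = s≤s ih
    ... | yes _ | yes _ | yes _ = s≤s (≤-trans ih (+-monoʳ-≤ _ (n≤1+n _)))
    ... | yes _ | no  _ | yes _ = ≤-trans (s≤s ih) (≤-reflexive (sym (+-suc _ _)))
    ... | no  _ | yes _ | no  _ = m≤n⇒m≤1+n ih
    ... | no  _ | yes _ | yes _ = m≤n⇒m≤1+n (≤-trans ih (+-monoʳ-≤ _ (n≤1+n _)))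
    ... | no  _ | no  _ | yes _ = ≤-trans ih (+-monoʳ-≤ _ (n≤1+n _))
    ... | no  _ | no  _ | no  _ = ih
    ... | yes r | no ¬p | no ¬q with R⇒P⊎Q r
    ...   | inj₁ p = contradiction p ¬p
    ...   | inj₂ q = contradiction q ¬q

    length-filter-disjoint : ∀ xs →
      (∀ {x} → x ∈ xs → P x → R x) → (∀ {x} → x ∈ xs → Q x → R x) →
      (∀ {x} → x ∈ xs → P x → ¬ Q x) →
      length (filter P? xs) + length (filter Q? xs) ≤ length (filter R? xs)
    length-filter-disjoint [] P⇒R Q⇒R P⇒¬Q = z≤n
    length-filter-disjoint (x ∷ xs) P⇒R Q⇒R P⇒¬Q
      with ih ← length-filter-disjoint xs (P⇒R ∘ there) (Q⇒R ∘ there) (P⇒¬Q ∘ there)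
         | P? x | Q? x | R? x
    ... | yes p | yes q | _     = contradiction q (P⇒¬Q (here refl) p)
    ... | yes p | _     | no ¬r = contradiction (P⇒R (here refl) p) ¬r
    ... | no  _ | yes q | no ¬r = contradiction (Q⇒R (here refl) q) ¬r
    ... | yes _ | no  _ | yes _ = s≤s ih
    ... | no  _ | yes _ | yes _ = ≤-trans (≤-reflexive (+-suc _ _)) (s≤s ih)
    ... | no  _ | no  _ | yes _ = m≤n⇒m≤1+n ih
    ... | no  _ | no  _ | no  _ = ih

half-mono : ∀ {m n} → m + m ≤ n + n → m ≤ n
half-mono {m} {n} m+m≤n+n with m ≤? n
... | yes m≤n = m≤n
... | no m≰n  = contradiction m+m≤n+n (<⇒≱ (+-mono-< (≰⇒> m≰n) (≰⇒> m≰n)))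

any-true : ∀ {A : Set} {p : A → Bool} xs → any p xs ≡ true → ∃[ x ] p x ≡ true
any-true {p = p} (x ∷ xs) eq with p x in px
... | true  = x , px
... | false = any-true xs eq

∈⇒any : ∀ {A : Set} {p : A → Bool} {x} xs → x ∈ xs → p x ≡ true → any p xs ≡ true
∈⇒any {p = p} (x ∷ xs) (here refl) px rewrite px = refl
∈⇒any {p = p} (y ∷ xs) (there x∈xs) px with p y
... | true  = refl
... | false = ∈⇒any xs x∈xs px

-- Slots are numbered from `1`; the number `0` is kept for colours without a slot.
anySlot : ℕ → (ℕ → Bool) → Bool
anySlot zero    p = false
anySlot (suc j) p = p (suc j) ∨ anySlot j p

anySlot-true : ∀ {p} k → anySlot k p ≡ true → ∃[ j ] p j ≡ true
anySlot-true {p} (suc k) eq with p (suc k) in pk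
... | true  = suc k , pk
... | false = anySlot-true k eq

≤⇒anySlot : ∀ {p j} k → 0 < j → j ≤ k → p j ≡ true → anySlot k p ≡ true
≤⇒anySlot {j = suc _} zero    0<j () pj
≤⇒anySlot {p} {j}     (suc k) 0<j j≤k pj with m≤n⇒m<n∨m≡n j≤k
... | inj₂ refl rewrite pj = refl
... | inj₁ j<k with p (suc k)
...   | true  = refl
...   | false = ≤⇒anySlot k 0<j (≤-pred j<k) pj

-- Greedy localisation

module Algorithm {V C : Set} (_≟ⱽ_ : DecidableEquality V) (_≟ᶜ_ : DecidableEquality C) where

  open DecMembership _≟ⱽ_ using (_∈?_)

  Edge Label : Set
  Edge  = V × V × C
  Label = V × ℕ

  colour : Edge → C
  colour (_ , _ , c) = c

  -- Branching may give a vertex two different slots; such a vertex is compatible with no slot at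
  -- all.
  Compatible : V → ℕ → List Label → Set
  Compatible x j = All (λ (y , i) → x ≡ y → j ≡ i)

  compatible? : ∀ x j ls → Dec (Compatible x j ls)
  compatible? x j = all? (λ (y , i) → (x ≟ⱽ y) →-dec (j ≟ i))

  Candidate : ℕ → List Label → C → Edge → Set
  Candidate j ls c (u , v , d) = d ≡ c × Compatible u j ls × Compatible v j ls

  candidate? : ∀ j ls c e → Dec (Candidate j ls c e)
  candidate? j ls c (u , v , d) = (d ≟ᶜ c) ×-dec compatible? u j ls ×-dec compatible? v j ls

  endLabels : ℕ → Edge → List Label
  endLabels j (u , v , _) = (u , j) ∷ (v , j) ∷ []

  -- Labels are added even if present already, so that the length grows by exactly two per claimed
  -- edge.
  claim : ℕ → List Label → C → List Edge → List Label
  claim j ls c E = concatMap (endLabels j) (filter (candidate? j ls c) E) ++ ls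

  -- Trying the colours of the edges suffices, as any other colour claims nothing.
  best : List Edge → ℕ → List Label → List Edge → List Label
  best E j ls []      = ls
  best E j ls (e ∷ F) =
    if length (claim j ls (colour e) E) ≤ᵇ length (best E j ls F)
    then best E j ls F
    else claim j ls (colour e) E

  -- Slots are served in descending order, so the slots already served are those with numbers above
  -- `j`.
  greedy : List Edge → ℕ → List Label → List Label
  greedy E zero    ls = ls
  greedy E (suc j) ls = greedy E j (best E (suc j) ls E)

  -- The threshold `length ls + (k + k)` amounts to `k` claimed edges, since the labels given are
  -- counted on both sides. The argument `d` is the number of labels that may still be guessed.
  search : List Edge → ℕ → ℕ → List Label → Bool
  branch : List Edge → ℕ → ℕ → List Label → Bool

  search E k d ls =
    if length ls + (k + k) ≤ᵇ length (greedy E k ls) then true else branch E k d ls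

  branch E k zero    ls = false
  branch E k (suc d) ls =
    any (λ (x , _) → anySlot k (λ j → search E k d ((x , j) ∷ ls))) (greedy E k ls)

  length-endLabels : ∀ j F → length (concatMap (endLabels j) F) ≡ length F + length F
  length-endLabels j []      = refl
  length-endLabels j (e ∷ F) =
    cong suc (trans (cong suc (length-endLabels j F)) (sym (+-suc (length F) (length F))))

  claimed : ℕ → List Label → C → List Edge → ℕ
  claimed j ls c E = length (filter (candidate? j ls c) E)

  length-claim : ∀ j ls c E →
    length (claim j ls c E) ≡ claimed j ls c E + claimed j ls c E + length ls
  length-claim j ls c E = trans
    (length-++ (concatMap (endLabels j) (filter (candidate? j ls c) E)))
    (cong (_+ length ls) (length-endLabels j (filter (candidate? j ls c) E)))

  length-claim-≤ : ∀ j ls c E → length (claim j ls c E) ≤ length E + length E + length ls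
  length-claim-≤ j ls c E rewrite length-claim j ls c E =
    +-monoˡ-≤ _ (+-mono-≤ (length-filter (candidate? j ls c) E) (length-filter (candidate? j ls c) E))

  best-cases : ∀ E j ls F →
    best E j ls F ≡ ls ⊎ (∃[ c ] best E j ls F ≡ claim j ls c E)
  best-cases E j ls []      = inj₁ refl
  best-cases E j ls (e ∷ F)
    with length (claim j ls (colour e) E) ≤ᵇ length (best E j ls F)
       | ≤ᵇ-reflects-≤ (length (claim j ls (colour e) E)) (length (best E j ls F))
  ... | true  | _ = best-cases E j ls F
  ... | false | _ = inj₂ (colour e , refl)

  claim≤best : ∀ E j ls {F e} → e ∈ F →
    length (claim j ls (colour e) E) ≤ length (best E j ls F)
  claim≤best E j ls {e ∷ F} (here refl)
    with length (claim j ls (colour e) E) ≤ᵇ length (best E j ls F)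
       | ≤ᵇ-reflects-≤ (length (claim j ls (colour e) E)) (length (best E j ls F))
  ... | true  | ofʸ p = p
  ... | false | _     = ≤-refl
  claim≤best E j ls {e ∷ F} (there e∈F)
    with length (claim j ls (colour e) E) ≤ᵇ length (best E j ls F)
       | ≤ᵇ-reflects-≤ (length (claim j ls (colour e) E)) (length (best E j ls F))
  ... | true  | _      = claim≤best E j ls e∈F
  ... | false | ofⁿ ¬p = ≤-trans (claim≤best E j ls e∈F) (≰⇒≥ ¬p)

  best-extends : ∀ E j ls F → ∃[ ms ] best E j ls F ≡ ms ++ ls
  best-extends E j ls F with best-cases E j ls F
  ... | inj₁ eq       = [] , eq
  ... | inj₂ (c , eq) = _ , eq

  length-best : ∀ E j ls F → length ls ≤ length (best E j ls F)
  length-best E j ls F with ms , eq ← best-extends E j ls F rewrite eq =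
    ≤-trans (m≤n+m _ (length ms)) (≤-reflexive (sym (length-++ ms)))

  length-best-≤ : ∀ E j ls F → length (best E j ls F) ≤ length E + length E + length ls
  length-best-≤ E j ls F with best-cases E j ls F
  ... | inj₁ eq rewrite eq = m≤n+m _ _
  ... | inj₂ (c , eq) rewrite eq = length-claim-≤ j ls c E

  All-best⁻ : ∀ {P : Pred Label 0ℓ} E j ls F → All P (best E j ls F) → All P ls
  All-best⁻ E j ls F p with ms , eq ← best-extends E j ls F rewrite eq = ++⁻ʳ ms p

  All-greedy⁻ : ∀ {P : Pred Label 0ℓ} E j ls → All P (greedy E j ls) → All P ls
  All-greedy⁻ E zero    ls p = p
  All-greedy⁻ E (suc j) ls p = All-best⁻ E (suc j) ls E (All-greedy⁻ E j _ p)

  -- Label lists only grow, so compatibility at the moment of a claim implies compatibility with the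
  -- initial `ls`. This will show that a wrong label found by the greedy step sits on a vertex not
  -- yet guessed.
  greedy-new-compatible : ∀ {x i} E j ls → (x , i) ∈ greedy E j ls → (x , i) ∈ ls ⊎ Compatible x i ls
  greedy-new-compatible E zero    ls x∈ = inj₁ x∈
  greedy-new-compatible {x} {i} E (suc j) ls x∈ with greedy-new-compatible E j (best E (suc j) ls E) x∈
  ... | inj₂ p = inj₂ (All-best⁻ E (suc j) ls E p)
  ... | inj₁ p with best-cases E (suc j) ls E
  ...   | inj₁ eq = inj₁ (subst ((x , i) ∈_) eq p)
  ...   | inj₂ (c , eq) with ∈-++⁻ (concatMap (endLabels (suc j)) (filter (candidate? (suc j) ls c) E))
                                  (subst ((x , i) ∈_) eq p)
  ...     | inj₂ q = inj₁ q
  ...     | inj₁ q = inj₂ (go (all-filter (candidate? (suc j) ls c) E) q)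
    where
    go : ∀ {F} → All (Candidate (suc j) ls c) F → (x , i) ∈ concatMap (endLabels (suc j)) F →
      Compatible x i ls
    go ((_ , cu , _) ∷ _) (here refl)         = cu
    go ((_ , _ , cv) ∷ _) (there (here refl)) = cv
    go (_ ∷ all)          (there (there r))   = go all r

  Stable : (V → C) → Edge → Set
  Stable f (u , v , c) = c ≡ f u × f u ≡ f v

  stable? : ∀ f e → Dec (Stable f e)
  stable? f (u , v , c) = (c ≟ᶜ f u) ×-dec (f u ≟ᶜ f v)

  -- Soundness: a colouring built from the claims

  module Soundness (E : List Edge) where

    -- Separates the vertices open to later claims from those already used: compatibility with a
    -- slot up to `j` implies it, and a label of a slot served earlier violates it.
    Below : ℕ → List Label → V → Set
    Below j ls x = All (λ (y , i) → x ≡ y → i ≤ j) ls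

    below? : ∀ j ls x → Dec (Below j ls x)
    below? j ls x = all? (λ (y , i) → (x ≟ⱽ y) →-dec (i ≤? j)) ls

    Settled : (V → C) → ℕ → List Label → Edge → Set
    Settled f j ls e@(u , v , _) = Stable f e × Below j ls u × Below j ls v

    settled? : ∀ f j ls e → Dec (Settled f j ls e)
    settled? f j ls e@(u , v , _) = stable? f e ×-dec below? j ls u ×-dec below? j ls v

    below-suc : ∀ {j ls x} → Below j ls x → Below (suc j) ls x
    below-suc = All.map (λ p eq → m≤n⇒m≤1+n (p eq))

    compatible⇒below : ∀ {j ls x} → Compatible x j ls → Below j ls x
    compatible⇒below = All.map (λ p eq → ≤-reflexive (sym (p eq)))

    endLabels-∈ : ∀ {j e F x} → e ∈ F → (x , j) ∈ endLabels j e →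
      ∀ ls → (x , j) ∈ concatMap (endLabels j) F ++ ls
    endLabels-∈ (here refl) (here refl)         ls = here refl
    endLabels-∈ (here refl) (there (here refl)) ls = there (here refl)
    endLabels-∈ (there p)   q                   ls = there (there (endLabels-∈ p q ls))

    -- Every vertex with a label above `j` receives `c`, not just those labelled `suc j`. This is
    -- harmless, as edges settled at `j` have no such endpoint.
    recolour : ℕ → List Label → C → (V → C) → V → C
    recolour j ls c f x = if does (below? j ls x) then f x else c

    recolour-below : ∀ {j ls c f x} → Below j ls x → recolour j ls c f x ≡ f x
    recolour-below {j} {ls} {x = x} p rewrite dec-true (below? j ls x) p = refl

    recolour-above : ∀ {j ls c f x} → (x , suc j) ∈ ls → recolour j ls c f x ≡ c
    recolour-above {j} {ls} {x = x} p with below? j ls x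
    ... | yes q = contradiction (All.lookup q p refl) 1+n≰n
    ... | no  _ = refl

    -- Recolouring the endpoints of the edges claimed for slot suc j spoils
    -- no edge claimed later: none of its endpoints carries the label suc j.
    greedy-sound : ∀ j ls (f : V → C) → ∃[ f′ ]
      length (greedy E j ls) ≤
        length (filter (settled? f′ j ls) E) + length (filter (settled? f′ j ls) E) + length ls
    greedy-sound zero    ls f = f , m≤n+m _ _
    greedy-sound (suc j) ls f with best-cases E (suc j) ls E
    ... | inj₁ eq rewrite eq with f′ , p ← greedy-sound j ls f =
      f′ , ≤-trans p (+-monoˡ-≤ _ (+-mono-≤ q q))
      where
      q : length (filter (settled? f′ j ls) E) ≤ length (filter (settled? f′ (suc j) ls) E)
      q = length-filter-mono (settled? f′ j ls) (settled? f′ (suc j) ls) (⊆-refl {x = E})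
        (λ { _ (s , a , b) → s , below-suc a , below-suc b })
    ... | inj₂ (c , eq) rewrite eq with f′ , p ← greedy-sound j (claim (suc j) ls c E) f =
      f″ , (begin
        length (greedy E j μ)                ≤⟨ p ⟩
        old + old + length μ                 ≡⟨ cong (old + old +_) (length-claim (suc j) ls c E) ⟩
        old + old + (add + add + length ls)  ≡⟨ rearrange old add (length ls) ⟩
        add + old + (add + old) + length ls  ≤⟨ +-monoˡ-≤ (length ls) (+-mono-≤ total total) ⟩
        new + new + length ls                ∎)
      where
      open ≤-Reasoning
      μ   = claim (suc j) ls c E
      f″  = recolour j μ c f′
      old = length (filter (settled? f′ j μ) E)
      add = claimed (suc j) ls c E
      new = length (filter (settled? f″ (suc j) ls) E)

      rearrange : ∀ a b c → a + a + (b + b + c) ≡ b + a + (b + a) + c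
      rearrange = solve-∀

      below : ∀ {x} → Below j μ x → Below (suc j) ls x
      below = below-suc ∘ ++⁻ʳ (concatMap (endLabels (suc j)) (filter (candidate? (suc j) ls c) E))

      claimed-above : ∀ {e x} → e ∈ E → Candidate (suc j) ls c e →
        (x , suc j) ∈ endLabels (suc j) e → (x , suc j) ∈ μ
      claimed-above e∈E p q = endLabels-∈ (∈-filter⁺ (candidate? (suc j) ls c) e∈E p) q ls

      total : add + old ≤ new
      total = length-filter-disjoint (candidate? (suc j) ls c) (settled? f′ j μ) (settled? f″ (suc j) ls) E
        (λ { e∈E p@(refl , cu , cv) →
               let fu = recolour-above {f = f′} (claimed-above e∈E p (here refl))
                   fv = recolour-above {f = f′} (claimed-above e∈E p (there (here refl)))
               in (sym fu , trans fu (sym fv)) , compatible⇒below cu , compatible⇒below cv })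
        (λ { _ ((c≡fu , fu≡fv) , bu , bv) →
               ( trans c≡fu (sym (recolour-below {c = c} {f = f′} bu))
               , trans (recolour-below {c = c} {f = f′} bu) 
                   (trans fu≡fv (sym (recolour-below {c = c} {f = f′} bv))))
               , below bu , below bv })
        (λ { e∈E p (_ , bu , _) →
               contradiction (All.lookup bu (claimed-above e∈E p (here refl)) refl) 1+n≰n })

    search-sound : ∀ k d ls (f : V → C) → search E k d ls ≡ true →
      ∃[ f′ ] k ≤ length (filter (stable? f′) E)
    branch-sound : ∀ k d ls (f : V → C) → branch E k d ls ≡ true →
      ∃[ f′ ] k ≤ length (filter (stable? f′) E)

    search-sound k d ls f eq
      with length ls + (k + k) ≤ᵇ length (greedy E k ls)
         | ≤ᵇ-reflects-≤ (length ls + (k + k)) (length (greedy E k ls))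
    ... | false | _ = branch-sound k d ls f eq
    ... | true  | ofʸ p with f′ , q ← greedy-sound k ls f =
      f′ , ≤-trans (half-mono (+-cancelʳ-≤ (length ls) _ _
             (≤-trans (≤-reflexive (+-comm (k + k) (length ls))) (≤-trans p q))))
             (length-filter-mono (settled? f′ k ls) (stable? f′) (⊆-refl {x = E}) (λ _ → proj₁))

    branch-sound k (suc d) ls f eq
      with (x , _) , eq₁ ← any-true (greedy E k ls) eq
      with j , eq₂ ← anySlot-true k eq₁ =
      search-sound k d ((x , j) ∷ ls) f eq₂

  -- Completeness: the branch that follows a solution

  slot : List C → C → ℕ
  slot []       c = 0
  slot (d ∷ ds) c = if does (c ≟ᶜ d) then suc (length ds) else slot ds c

  slot-≤ : ∀ ds c → slot ds c ≤ length ds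
  slot-≤ []       c = z≤n
  slot-≤ (d ∷ ds) c with c ≟ᶜ d
  ... | yes _ = ≤-refl
  ... | no  _ = m≤n⇒m≤1+n (slot-≤ ds c)

  slot-positive : ∀ {ds c} → c ∈ ds → 0 < slot ds c
  slot-positive {d ∷ ds} {c} c∈ds with c ≟ᶜ d
  ... | yes _ = z<s
  slot-positive (here c≡d)   | no c≢d = contradiction c≡d c≢d
  slot-positive (there c∈ds) | no _   = slot-positive c∈ds

  -- A colour found at the head gets a number exceeding all those given by the tail. Positivity
  -- excludes absent colours, which share the value `0`.
  slot-injective : ∀ ds {c c′} → 0 < slot ds c → slot ds c ≡ slot ds c′ → c ≡ c′
  slot-injective (d ∷ ds) {c} {c′} pos eq with c ≟ᶜ d | c′ ≟ᶜ d
  ... | yes refl | yes refl = refl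
  ... | yes _    | no  _    = contradiction (≤-trans (≤-reflexive eq) (slot-≤ ds c′)) 1+n≰n
  ... | no  _    | yes _    = contradiction (≤-trans (≤-reflexive (sym eq)) (slot-≤ ds c)) 1+n≰n
  ... | no  _    | no  _    = slot-injective ds pos eq

  module Completeness (E O : List Edge) (O⊆E : O ⊆ E) (f : V → C) (stable : All (Stable f) O) where

    ends : List Edge → List V
    ends = concatMap (λ (u , v , _) → u ∷ v ∷ [])

    length-ends : ∀ F → length (ends F) ≡ length F + length F
    length-ends []      = refl
    length-ends (e ∷ F) = cong suc (trans (cong suc (length-ends F)) (sym (+-suc (length F) (length F))))

    left-end : ∀ {u v c F} → (u , v , c) ∈ F → u ∈ ends F
    left-end (here refl) = here refl
    left-end (there p)   = there (there (left-end p))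

    right-end : ∀ {u v c F} → (u , v , c) ∈ F → v ∈ ends F
    right-end (here refl) = there (here refl)
    right-end (there p)   = there (there (right-end p))

    slotOf : C → ℕ
    slotOf = slot (map colour O)

    slotOf-colour-positive : ∀ {e} → e ∈ O → 0 < slotOf (colour e)
    slotOf-colour-positive e∈O = slot-positive (∈-map⁺ colour e∈O)

    ends-slot : ∀ {x} → x ∈ ends O → 0 < slotOf (f x)
    ends-slot = go stable slotOf-colour-positive
      where
      go : ∀ {F x} → All (Stable f) F → (∀ {e} → e ∈ F → 0 < slotOf (colour e)) →
        x ∈ ends F → 0 < slotOf (f x)
      go ((c≡fu , _) ∷ _) pos (here refl) rewrite sym c≡fu = pos (here refl)
      go ((c≡fu , fu≡fv) ∷ _) pos (there (here refl)) rewrite sym fu≡fv | sym c≡fu = pos (here refl)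
      go (_ ∷ st) pos (there (there p)) = go st (pos ∘ there) p

    -- Labels away from the endpoints of `O` are left free: they cannot keep a slot from claiming
    -- its edges of `O`.
    Consistent : List Label → Set
    Consistent = All (λ (x , i) → x ∈ ends O → i ≡ slotOf (f x))

    consistent? : ∀ ls → Dec (Consistent ls)
    consistent? = all? (λ (x , i) → (x ∈? ends O) →-dec (i ≟ slotOf (f x)))

    consistent⇒compatible : ∀ {ls x j} → Consistent ls → x ∈ ends O → j ≡ slotOf (f x) →
      Compatible x j ls
    consistent⇒compatible con x∈ j≡ = All.map (λ { p refl → trans j≡ (sym (p x∈)) }) con

    slot≤? : ∀ j → Decidable (λ e → slotOf (colour e) ≤ j)
    slot≤? j e = slotOf (colour e) ≤? j

    slot≡? : ∀ j → Decidable (λ e → slotOf (colour e) ≡ j)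
    slot≡? j e = slotOf (colour e) ≟ j

    O-in-slot : ℕ → ℕ
    O-in-slot j = length (filter (slot≡? j) O)

    O-up-to : ℕ → ℕ
    O-up-to j = length (filter (slot≤? j) O)

    -- Edges of `O` in one slot share their colour by injectivity of `slot`, and consistent labels
    -- never bar an endpoint from its own slot.
    candidate : ∀ {j ls e e′} → Consistent ls → e ∈ O → slotOf (colour e) ≡ j → e′ ∈ O →
      slotOf (colour e′) ≡ j → Candidate j ls (colour e) e′
    candidate {e′ = u , v , d} con e∈O refl e′∈O eq with c≡fu , fu≡fv ← All.lookup stable e′∈O =
      slot-injective (map colour O) (slotOf-colour-positive e′∈O) eq ,
      consistent⇒compatible con (left-end e′∈O) (trans (sym eq) (cong slotOf c≡fu)) ,
      consistent⇒compatible con (right-end e′∈O) (trans (sym eq) (cong slotOf (trans c≡fu fu≡fv)))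

    -- If the slot contains an edge of `O`, the colour of that edge is among those tried by `best`,
    -- and claiming it catches all of `O` in the slot.
    best-complete : ∀ j ls → Consistent ls →
      O-in-slot j + O-in-slot j + length ls ≤ length (best E j ls E)
    best-complete j ls con with filter (slot≡? j) O in eq
    ... | []    = length-best E j ls E
    ... | e ∷ F
      with e∈O , slot-e ← ∈-filter⁻ (slot≡? j) {xs = O} (subst (e ∈_) (sym eq) (here refl)) = begin
      suc (length F) + suc (length F) + length ls
        ≡⟨ cong (λ l → length l + length l + length ls) (sym eq) ⟩
      O-in-slot j + O-in-slot j + length ls
        ≤⟨ +-monoˡ-≤ (length ls) (+-mono-≤ more more) ⟩
      claimed j ls (colour e) E + claimed j ls (colour e) E + length ls
        ≡⟨ length-claim j ls (colour e) E ⟨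
      length (claim j ls (colour e) E)
        ≤⟨ claim≤best E j ls (lookup O⊆E e∈O) ⟩
      length (best E j ls E) ∎
      where
      open ≤-Reasoning
      more : O-in-slot j ≤ claimed j ls (colour e) E
      more = length-filter-mono (slot≡? j) (candidate? j ls (colour e)) O⊆E (candidate con e∈O slot-e)

    -- Consistency is required of the final labels only: every intermediate list is a suffix of the
    -- final one and inherits it.
    greedy-complete : ∀ j ls → Consistent (greedy E j ls) →
      O-up-to j + O-up-to j + length ls ≤ length (greedy E j ls)
    greedy-complete zero ls con = ≤-reflexive (cong (λ l → l + l + length ls) none)
      where
      none : O-up-to 0 ≡ 0
      none = cong length (filter-none (slot≤? 0)
        (All.tabulate (λ e∈O → <⇒≱ (slotOf-colour-positive e∈O))))
    greedy-complete (suc j) ls con = begin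
      O-up-to (suc j) + O-up-to (suc j) + length ls
        ≤⟨ +-monoˡ-≤ (length ls) (+-mono-≤ split split) ⟩
      (a + b) + (a + b) + length ls
        ≡⟨ rearrange a b (length ls) ⟩
      b + b + (a + a + length ls)
        ≤⟨ +-monoʳ-≤ (b + b) (best-complete (suc j) ls
             (All-best⁻ E (suc j) ls E (All-greedy⁻ E j _ con))) ⟩
      b + b + length (best E (suc j) ls E)
        ≤⟨ greedy-complete j (best E (suc j) ls E) con ⟩
      length (greedy E (suc j) ls) ∎
      where
      open ≤-Reasoning
      a = O-in-slot (suc j)
      b = O-up-to j
      rearrange : ∀ a b c → (a + b) + (a + b) + c ≡ b + b + (a + a + c)
      rearrange = solve-∀
      cases : ∀ {m} → m ≤ suc j → m ≡ suc j ⊎ m ≤ j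
      cases m≤ with m≤n⇒m<n∨m≡n m≤
      ... | inj₁ (s≤s m≤j) = inj₂ m≤j
      ... | inj₂ m≡      = inj₁ m≡
      split : O-up-to (suc j) ≤ a + b
      split = length-filter-⊎ (slot≡? (suc j)) (slot≤? j) (slot≤? (suc j)) cases O

    Unlabelled : List Label → V → Set
    Unlabelled ls x = All (λ (y , _) → x ≢ y) ls

    unlabelled? : ∀ ls → Decidable (Unlabelled ls)
    unlabelled? ls x = all? (λ (y , _) → ¬? (x ≟ⱽ y)) ls

    -- The measure that decreases along the right branch. Endpoints are counted with multiplicity,
    -- so it starts at no more than twice the length of `O`.
    unlabelledEnds : List Label → ℕ
    unlabelledEnds ls = length (filter (unlabelled? ls) (ends O))

    unlabelledEnds-∷ : ∀ {x} j ls → x ∈ ends O → Unlabelled ls x →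
      unlabelledEnds ((x , j) ∷ ls) < unlabelledEnds ls
    unlabelledEnds-∷ j ls x∈ u =
      length-filter-strict (unlabelled? (_ ∷ ls)) (unlabelled? ls) x∈
        (λ { (_ ∷ p) → p }) u (λ { (x≢x ∷ _) → x≢x refl })

    O-up-to-all : O-up-to (length O) ≡ length O
    O-up-to-all = cong length (filter-all (slot≤? (length O)) {O}
      (All.universal (λ e → ≤-trans (slot-≤ (map colour O) (colour e))
                                    (≤-reflexive (length-map colour O))) O))

    inconsistent : ∀ ls → ¬ Consistent ls →
      ∃[ x ] ∃[ i ] (x , i) ∈ ls × x ∈ ends O × i ≢ slotOf (f x)
    inconsistent ls ¬con
      with find (¬All⇒Any¬ (λ (x , i) → (x ∈? ends O) →-dec (i ≟ slotOf (f x))) ls ¬con)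
    ... | (x , i) , x∈ , ¬p = x , i , x∈ ,
      decidable-stable (x ∈? ends O) (λ x∉ → ¬p (λ p → contradiction p x∉)) , (λ i≡ → ¬p (λ _ → i≡))

    search-complete : ∀ d ls → Consistent ls → unlabelledEnds ls ≤ d →
      search E (length O) d ls ≡ true
    search-complete d ls con fuel
      with length ls + (length O + length O) ≤ᵇ length (greedy E (length O) ls)
         | ≤ᵇ-reflects-≤ (length ls + (length O + length O)) (length (greedy E (length O) ls))
    ... | true  | _ = refl
    ... | false | ofⁿ short with consistent? (greedy E (length O) ls)
    -- With consistent labels the greedy step would have claimed as many edges as `O` has, and the
    -- test would have succeeded.
    ...   | yes con′ = contradiction
      (≤-trans (≤-reflexive (trans (+-comm (length ls) _)
                 (cong (λ l → l + l + length ls) (sym O-up-to-all))))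
               (greedy-complete (length O) ls con′))
      short
    ...   | no ¬con with x , i , xi∈ , x∈ , i≢ ← inconsistent (greedy E (length O) ls) ¬con = go d fuel
      where
      -- A label of `x` in `ls` would equal `i` by compatibility and the slot of `x` in the solution
      -- by consistency, but these differ.
      unlabelled : Unlabelled ls x
      unlabelled with greedy-new-compatible E (length O) ls xi∈
      ... | inj₁ xi∈ls  = contradiction (All.lookup con xi∈ls x∈) i≢
      ... | inj₂ compat = All.zipWith (λ { (p , q) refl → i≢ (trans (q refl) (p x∈)) }) (con , compat)

      x-slot≤ : slotOf (f x) ≤ length O
      x-slot≤ = ≤-trans (slot-≤ (map colour O) (f x)) (≤-reflexive (length-map colour O))

      go : ∀ d → unlabelledEnds ls ≤ d → branch E (length O) d ls ≡ true
      go zero    fuel = contradiction (<-≤-trans (unlabelledEnds-∷ 0 ls x∈ unlabelled) fuel) λ ()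
      go (suc d) fuel = ∈⇒any (greedy E (length O) ls) xi∈
        (≤⇒anySlot (length O) (ends-slot x∈) x-slot≤
          (search-complete d ((x , slotOf (f x)) ∷ ls) ((λ _ → refl) ∷ con)
            (≤-pred (≤-trans (unlabelledEnds-∷ (slotOf (f x)) ls x∈ unlabelled) fuel))))

  search-correct : ∀ E k → (V → C) →
    search E k (k + k) [] ≡ true ⇔ (∃[ f ] k ≤ length (filter (stable? f) E))
  search-correct E k f₀ = mk⇔ (Soundness.search-sound E k (k + k) [] f₀) complete
    where
    complete : ∃[ f ] k ≤ length (filter (stable? f) E) → search E k (k + k) [] ≡ true
    complete (f , k≤) = subst (λ k → search E k (k + k) [] ≡ true) |O|≡k
      (search-complete (length O + length O) []
        [] (≤-trans (length-filter (unlabelled? []) (ends O)) (≤-reflexive (length-ends O))))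
      where
      -- Cutting down to exactly `k` edges makes the number of slots agree with `length O` and the
      -- depth `k + k` with the number of endpoints.
      O = take k (filter (stable? f) E)
      |O|≡k : length O ≡ k
      |O|≡k = trans (length-take k (filter (stable? f) E)) (m≤n⇒m⊓n≡m k≤)
      open Completeness E O (⊆-trans (take-⊆ k _) (filter-⊆ (stable? f) E)) f
        (take⁺ k (all-filter (stable? f) E))

-- Bounding running times

bool : Bool → Tree
bool false = leaf
bool true  = leaf ∙ leaf

-- Abstract, lest K be unfolded to a unary numeral in the cost bounds.
abstract
  K : ℕ
  K = 100

  ≤ᵇ100⇒≤K : ∀ {c} → T (c ≤ᵇ 100) → c ≤ K
  ≤ᵇ100⇒≤K {c} = ≤ᵇ⇒≤ c 100

module Cost {m : ℕ} (fs : Vec (Exp m 1) m) where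

  -- Run ρ e v c ts: e evaluates to v, within c steps plus the costs ts of
  -- the calls.  With the calls kept apart, c is a numeral.
  record Run {n} (ρ : Vec Tree n) (e : Exp m n) (v : Tree) (c : ℕ) (ts : List ℕ) : Set where
    constructor run
    field
      {steps}    : ℕ
      derivation : fs ∣ ρ ⊢ e ⇓ v ⟨ steps ⟩
      bound      : steps ≤ c + sum ts

  record Call (f : Fin m) (x v : Tree) (b : ℕ) : Set where
    constructor call
    field
      {steps}    : ℕ
      derivation : fs ∣ x ∷ [] ⊢ Vec.lookup fs f ⇓ v ⟨ steps ⟩
      bound      : steps ≤ b

  private
    add-bounds : ∀ {s t c d} ts us → s ≤ c + sum ts → t ≤ d + sum us →
      suc (s + t) ≤ suc (c + d) + sum (ts ++ us)
    add-bounds {s} {t} {c} {d} ts us p q = begin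
      suc (s + t)                       ≤⟨ s≤s (+-mono-≤ p q) ⟩
      suc (c + sum ts + (d + sum us))   ≡⟨ rearrange c (sum ts) d (sum us) ⟩
      suc (c + d) + (sum ts + sum us)   ≡⟨ cong (suc (c + d) +_) (sum-++ ts us) ⟨
      suc (c + d) + sum (ts ++ us)      ∎
      where
      open ≤-Reasoning
      rearrange : ∀ a b c d → suc (a + b + (c + d)) ≡ suc (a + c) + (b + d)
      rearrange = solve-∀

  var! : ∀ {n} {ρ : Vec Tree n} {i} → Run ρ (var i) (Vec.lookup ρ i) 1 []
  var! = run ⇓var ≤-refl

  leaf! : ∀ {n} {ρ : Vec Tree n} → Run ρ leaf leaf 1 []
  leaf! = run ⇓leaf ≤-refl

  module _ {n} {ρ : Vec Tree n} {c c′ : ℕ} {ts ts′ : List ℕ} where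

    cons! : ∀ {d e x y} → Run ρ d x c ts → Run ρ e y c′ ts′ →
      Run ρ (cons d e) (x ∙ y) (suc (c + c′)) (ts ++ ts′)
    cons! (run p a) (run q b) = run (⇓cons p q) (add-bounds ts ts′ a b)

    case-leaf! : ∀ {e d₁ d₂ v} → Run ρ e leaf c ts → Run ρ d₁ v c′ ts′ →
      Run ρ (case e d₁ d₂) v (suc (c + c′)) (ts ++ ts′)
    case-leaf! (run p a) (run q b) = run (⇓case-leaf p q) (add-bounds ts ts′ a b)

    case-node! : ∀ {e d₁ d₂ x y v} → Run ρ e (x ∙ y) c ts → Run (x ∷ y ∷ ρ) d₂ v c′ ts′ →
      Run ρ (case e d₁ d₂) v (suc (c + c′)) (ts ++ ts′)
    case-node! (run p a) (run q b) = run (⇓case-node p q) (add-bounds ts ts′ a b)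

    letting! : ∀ {d e x v} → Run ρ d x c ts → Run (x ∷ ρ) e v c′ ts′ →
      Run ρ (letting d e) v (suc (c + c′)) (ts ++ ts′)
    letting! (run p a) (run q b) = run (⇓letting p q) (add-bounds ts ts′ a b)

  call! : ∀ {n} {ρ : Vec Tree n} {f e x v c ts b} → Run ρ e x c ts → Call f x v b →
    Run ρ (call f e) v (suc c) (ts ++ b ∷ [])
  call! {c = c} {ts} {b} (run p a) (call q b′) = run (⇓call p q) (≤-trans
    (add-bounds {d = 0} ts (b ∷ []) a (≤-trans b′ (m≤m+n b 0)))
    (≤-reflexive (cong (λ c → suc c + sum (ts ++ b ∷ [])) (+-identityʳ c))))

  -- Charges both branches, so that the cost does not depend on b.
  if! : ∀ {n} {ρ : Vec Tree n} b {e d₁ d₂ v₁ v₂ c c₁ c₂ ts ts₁ ts₂} →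
    Run ρ e (bool b) c ts → Run ρ d₁ v₁ c₁ ts₁ → Run (leaf ∷ leaf ∷ ρ) d₂ v₂ c₂ ts₂ →
    Run ρ (case e d₁ d₂) (if b then v₂ else v₁) (suc (c + (c₁ + c₂))) (ts ++ (ts₁ ++ ts₂))
  if! false {c₁ = c₁} {c₂} {ts} {ts₁} {ts₂} (run p a) (run q b) _ =
    run (⇓case-leaf p q) (add-bounds ts (ts₁ ++ ts₂) a (≤-trans b
      (+-mono-≤ (m≤m+n c₁ c₂) (≤-trans (m≤m+n (sum ts₁) (sum ts₂)) (≤-reflexive (sym (sum-++ ts₁ ts₂)))))))
  if! true {c₁ = c₁} {c₂} {ts} {ts₁} {ts₂} (run p a) _ (run q b) =
    run (⇓case-node p q) (add-bounds ts (ts₁ ++ ts₂) a (≤-trans b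
      (+-mono-≤ (m≤n+m c₂ c₁) (≤-trans (m≤n+m (sum ts₂) (sum ts₁)) (≤-reflexive (sym (sum-++ ts₁ ts₂)))))))

  returns : ∀ {f x v w c ts b} → Run (x ∷ []) (Vec.lookup fs f) v c ts →
    {T (c ≤ᵇ 100)} → v ≡ w → K + sum ts ≤ b → Call f x w b
  returns (run p a) {c≤100} refl le =
    call p (≤-trans a (≤-trans (+-monoˡ-≤ _ (≤ᵇ100⇒≤K c≤100)) le))

  relax : ∀ {f x v b b′} → b ≤ b′ → Call f x v b → Call f x v b′
  relax b≤b′ (call p a) = call p (≤-trans a b≤b′)

-- The program

pattern eqᶠ         = 0F
pattern compatibleᶠ = 1F
pattern claimᶠ      = 2F
pattern longerᶠ     = 3F
pattern bestᶠ       = 4F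
pattern greedyᶠ     = 5F
pattern searchᶠ     = 6F
pattern branchᶠ     = 7F
pattern slotsᶠ      = 8F
pattern doubleᶠ     = 9F

infixr 5 _⋆_

pattern _⋆_ d e = cons d e

split : ∀ {m n} → Exp m n → Exp m (2 + n) → Exp m n
split e d = case e leaf d

true! false! : ∀ {m n} → Exp m n
false! = leaf
true!  = cons leaf leaf

pattern v0  = var 0F
pattern v1  = var 1F
pattern v2  = var 2F
pattern v3  = var 3F
pattern v4  = var 4F
pattern v5  = var 5F
pattern v6  = var 6F
pattern v7  = var 7F
pattern v8  = var 8F
pattern v9  = var 9F
pattern v10 = var (Fin.suc 9F)
pattern v11 = var (Fin.suc (Fin.suc 9F))
pattern v12 = var (Fin.suc (Fin.suc (Fin.suc 9F)))
pattern v13 = var (Fin.suc (Fin.suc (Fin.suc (Fin.suc 9F))))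

-- Arguments, with labels ls, a slot j, a vertex x and a colour c:
--   eqᶠ          tree ∙ tree
--   compatibleᶠ  ls ∙ x ∙ j
--   claimᶠ       edges ∙ c ∙ j ∙ ls
--   longerᶠ      list ∙ list
--   bestᶠ        edges still to be tried ∙ edges ∙ j ∙ ls
--   greedyᶠ      j ∙ edges ∙ ls
--   searchᶠ      ls ∙ depth left ∙ (length ls + 2k) ∙ edges ∙ k
--   branchᶠ      labels still to be tried ∙ k ∙ next
--   slotsᶠ       j ∙ x ∙ next
-- where next is the argument of the searches in the branches, up to the
-- label to be added.  Recursive calls precede the tests, so that both
-- outcomes of a test cost the same calls.
eqBody compatibleBody claimBody longerBody bestBody greedyBody searchBody branchBody slotsBody
  doubleBody mainBody : Exp 10 1

eqBody =
  split v0
  (case v0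
    (case v1 true! false!)
    (case v3 false!
      (letting (call eqᶠ (v3 ⋆ v1))
      (case (call eqᶠ (v3 ⋆ v1)) false! v2))))

compatibleBody =
  split v0
  (case v0 true!
    (letting (call compatibleᶠ (v1 ⋆ v3))
    (split v4
    (split v3
    (case (call eqᶠ (v2 ⋆ v0)) v4
      (case (call eqᶠ (v5 ⋆ v3)) false! v8))))))

claimBody =
  split v0 (split v1 (split v1
  (case v4 v1
    (letting (call claimᶠ (v1 ⋆ v7))
    (split v1 (split v1
    (case (call eqᶠ (v1 ⋆ v9)) v4
    (case (call compatibleᶠ (v10 ⋆ v4 ⋆ v9)) v6
    (case (call compatibleᶠ (v12 ⋆ v4 ⋆ v11)) v8
      ((v8 ⋆ v13) ⋆ (v6 ⋆ v13) ⋆ v10))))))))))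

longerBody =
  split v0 (case v1 true! (case v2 false! (call longerᶠ (v1 ⋆ v3))))

bestBody =
  split v0 (split v1
  (case v2 (split v1 v1)
    (letting (call bestᶠ (v1 ⋆ v5))
    (split v1 (split v1
    (letting (call claimᶠ (v7 ⋆ v1 ⋆ v8))
    (case (call longerᶠ (v5 ⋆ v0)) v0 v7)))))))

greedyBody =
  split v0 (split v1
  (case v2 v1
    (call greedyᶠ (v1 ⋆ v2 ⋆ call bestᶠ (v2 ⋆ v2 ⋆ v4 ⋆ v3)))))

searchBody =
  split v0 (split v1 (split v1 (split v1
  (letting (call greedyᶠ (v1 ⋆ v0 ⋆ v6))
  (case (call longerᶠ (v0 ⋆ v3))
    (case v5 false! (call branchᶠ (v2 ⋆ v4 ⋆ v9 ⋆ v1 ⋆ (leaf ⋆ v5) ⋆ v6)))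
    true!)))))

branchBody =
  split v0
  (case v0 false!
    (letting (call branchᶠ (v1 ⋆ v3))
    (split v1 (split v6
    (case (call slotsᶠ (v0 ⋆ v2 ⋆ v1)) v4 true!)))))

slotsBody =
  split v0
  (case v0 false!
    (letting (call slotsᶠ (v1 ⋆ v3))
    (split v4 (split v1
    (case (call searchᶠ (((v2 ⋆ v7) ⋆ v0) ⋆ v1)) v4 true!)))))

doubleBody =
  case v0 leaf (leaf ⋆ leaf ⋆ call doubleᶠ v1)

mainBody =
  split v0 (split v0 (split v1
  (call searchᶠ (leaf ⋆ call doubleᶠ v5 ⋆ call doubleᶠ v5 ⋆ v1 ⋆ v5))))

bodies : Vec (Exp 10 1) 10
bodies =
  eqBody ∷ compatibleBody ∷ claimBody ∷ longerBody ∷ bestBody ∷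
  greedyBody ∷ searchBody ∷ branchBody ∷ slotsBody ∷ doubleBody ∷ []

open Cost bodies

-- Correctness and cost of comparison and doubling

loopCost : ℕ → List ℕ → ℕ
loopCost n ts = suc n * (K + sum ts)

loopCost-mono : ∀ {n n′} ts → n ≤ n′ → loopCost n ts ≤ loopCost n′ ts
loopCost-mono ts n≤n′ = *-monoˡ-≤ (K + sum ts) (s≤s n≤n′)

loop-zero : ∀ n ts → K + 0 ≤ loopCost n ts
loop-zero n ts = ≤-trans (+-monoʳ-≤ K z≤n) (m≤m+n (K + sum ts) _)

-- The recurrence of a loop that calls itself first and then makes the calls `ts`; its last round is
-- charged in full as well.
loop-suc : ∀ n ts → K + sum (loopCost n ts ∷ ts) ≤ loopCost (suc n) ts
loop-suc n ts = ≤-reflexive (rearrange K (loopCost n ts) (sum ts))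
  where
  rearrange : ∀ a b c → a + (b + c) ≡ a + c + b
  rearrange = solve-∀

_≡ᵗ_ : Tree → Tree → Bool
leaf    ≡ᵗ leaf    = true
leaf    ≡ᵗ (_ ∙ _) = false
(_ ∙ _) ≡ᵗ leaf    = false
(a ∙ b) ≡ᵗ (c ∙ d) = (a ≡ᵗ c) ∧ (b ≡ᵗ d)

-- Both trees are descended in step, so the first alone bounds the time. Hence no size bound on the
-- entries of a label list is ever required.
eq-call : ∀ x y → Call eqᶠ (x ∙ y) (bool (x ≡ᵗ y)) (size x * K)
eq-call leaf leaf =
  returns (case-node! var! $ case-leaf! var! $ case-leaf! var! (cons! leaf! leaf!)) refl
    ≤-refl
eq-call leaf (c ∙ d) =
  returns (case-node! var! $ case-leaf! var! $ case-node! var! leaf!) refl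
    ≤-refl
eq-call (a ∙ b) leaf =
  returns (case-node! var! $ case-node! var! $ case-leaf! var! leaf!) refl
    (+-monoʳ-≤ K z≤n)
eq-call (a ∙ b) (c ∙ d) =
  returns
    (case-node! var! $ case-node! var! $ case-node! var! $
      letting! (call! (cons! var! var!) (eq-call b d)) $
      if! (a ≡ᵗ c) (call! (cons! var! var!) (eq-call a c)) leaf! var!)
    (value (a ≡ᵗ c) (b ≡ᵗ d))
    (+-monoʳ-≤ K (≤-reflexive (begin
      size b * K + (size a * K + 0) ≡⟨ rearrange (size a * K) (size b * K) ⟩
      size a * K + size b * K       ≡⟨ *-distribʳ-+ K (size a) (size b) ⟨
      (size a + size b) * K         ∎)))
  where
  open ≡-Reasoning
  value : ∀ p q → (if p then bool q else leaf) ≡ bool (p ∧ q)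
  value false q = refl
  value true  q = refl
  rearrange : ∀ a b → b + (a + 0) ≡ a + b
  rearrange = solve-∀

≡ᵗ-refl : ∀ x → (x ≡ᵗ x) ≡ true
≡ᵗ-refl leaf    = refl
≡ᵗ-refl (x ∙ y) rewrite ≡ᵗ-refl x = ≡ᵗ-refl y

≡ᵗ-sound : ∀ x y → (x ≡ᵗ y) ≡ true → x ≡ y
≡ᵗ-sound leaf    leaf    eq = refl
≡ᵗ-sound (a ∙ b) (c ∙ d) eq with a ≡ᵗ c in ac
... | true = cong₂ _∙_ (≡ᵗ-sound a c ac) (≡ᵗ-sound b d eq)

≡ᵗ-encoding : ∀ {A : Set} {enc : A → Tree} → Injective _≡_ _≡_ enc → ∀ {x y} (x≟y : Dec (x ≡ y)) →
  (enc x ≡ᵗ enc y) ≡ does x≟y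
≡ᵗ-encoding {enc = enc} inj {x} (yes refl) = ≡ᵗ-refl (enc x)
≡ᵗ-encoding {enc = enc} inj {x} {y} (no x≢y) with enc x ≡ᵗ enc y in eq
... | false = refl
... | true  = contradiction (inj (≡ᵗ-sound (enc x) (enc y) eq)) x≢y

∙-injectiveʳ : ∀ {a b c d} → a ∙ b ≡ c ∙ d → b ≡ d
∙-injectiveʳ refl = refl

encodeUnary-injective : Injective _≡_ _≡_ encodeUnary
encodeUnary-injective {zero}  {zero}  eq = refl
encodeUnary-injective {suc m} {suc n} eq = cong suc (encodeUnary-injective (∙-injectiveʳ eq))

encodeBits-injective : Injective _≡_ _≡_ encodeBits
encodeBits-injective {ℕᵇ.zero}  {ℕᵇ.zero}  eq = refl
encodeBits-injective {2[1+ a ]} {2[1+ b ]} eq = cong 2[1+_] (encodeBits-injective (∙-injectiveʳ eq))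
encodeBits-injective {1+[2 a ]} {1+[2 b ]} eq = cong 1+[2_] (encodeBits-injective (∙-injectiveʳ eq))

encodeBinary-injective : Injective _≡_ _≡_ encodeBinary
encodeBinary-injective = fromℕ-injective ∘ encodeBits-injective

-- Encoded lists and unary numerals both carry their length on the right spine, so `longerᶠ` serves
-- for either.
spine : Tree → ℕ
spine leaf    = 0
spine (_ ∙ y) = suc (spine y)

spine-encodeList : ∀ {A : Set} (enc : A → Tree) xs → spine (encodeList (map enc xs)) ≡ length xs
spine-encodeList enc []       = refl
spine-encodeList enc (x ∷ xs) = cong suc (spine-encodeList enc xs)

spine-encodeUnary : ∀ n → spine (encodeUnary n) ≡ n
spine-encodeUnary zero    = refl
spine-encodeUnary (suc n) = cong suc (spine-encodeUnary n)

longer-call : ∀ x y → Call longerᶠ (x ∙ y) (bool (spine y ≤ᵇ spine x)) (loopCost (spine y) [])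
longer-call x leaf =
  returns (case-node! var! $ case-leaf! var! (cons! leaf! leaf!)) refl (loop-zero 0 [])
longer-call leaf (_ ∙ y) =
  returns (case-node! var! $ case-node! var! $ case-leaf! var! leaf!) refl
    (loop-zero (suc (spine y)) [])
longer-call (_ ∙ x) (_ ∙ y) =
  returns (case-node! var! $ case-node! var! $ case-node! var!
      (call! (cons! var! var!) (longer-call x y)))
    (value (spine y) (spine x)) (loop-suc (spine y) [])
  where
  value : ∀ m n → bool (m ≤ᵇ n) ≡ bool (suc m ≤ᵇ suc n)
  value zero    n = refl
  value (suc m) n = refl

encodeList-longer : ∀ {A : Set} (enc : A → Tree) xs ys →
  Call longerᶠ (encodeList (map enc xs) ∙ encodeList (map enc ys))
    (bool (length ys ≤ᵇ length xs)) (loopCost (length ys) [])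
encodeList-longer enc xs ys rewrite sym (spine-encodeList enc xs) | sym (spine-encodeList enc ys) =
  longer-call _ _

encodeUnary-longer : ∀ {A : Set} (enc : A → Tree) xs n →
  Call longerᶠ (encodeList (map enc xs) ∙ encodeUnary n)
    (bool (n ≤ᵇ length xs)) (loopCost n [])
encodeUnary-longer enc xs n =
  subst₂ (λ m l → Call longerᶠ (encodeList (map enc xs) ∙ encodeUnary n) (bool (m ≤ᵇ l)) (loopCost m []))
    (spine-encodeUnary n) (spine-encodeList enc xs) (longer-call _ _)

double-call : ∀ n → Call doubleᶠ (encodeUnary n) (encodeUnary (n + n)) (loopCost n [])
double-call zero    = returns (case-leaf! var! leaf!) refl (loop-zero 0 [])
double-call (suc n) =
  returns (case-node! var! (cons! leaf! (cons! leaf! (call! var! (double-call n)))))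
    (cong (λ l → leaf ∙ encodeUnary l) (sym (+-suc n n))) (loop-suc n [])

size-encodeUnary : ∀ n → size (encodeUnary n) ≡ suc (n + n)
size-encodeUnary zero    = refl
size-encodeUnary (suc n) =
  cong suc (cong suc (trans (size-encodeUnary n) (sym (+-suc n n))))

-- Correctness and cost of the greedy step and the search

module Execution {V C : Set} (_≟ⱽ_ : DecidableEquality V) (_≟ᶜ_ : DecidableEquality C)
  (encV : V → Tree) (encV-injective : Injective _≡_ _≡_ encV)
  (encC : C → Tree) (encC-injective : Injective _≡_ _≡_ encC) where

  open Algorithm _≟ⱽ_ _≟ᶜ_

  encLabel : Label → Tree
  encLabel (x , i) = encV x ∙ encodeUnary i

  encLabels : List Label → Tree
  encLabels ls = encodeList (map encLabel ls)

  encEdge : Edge → Tree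
  encEdge (u , v , c) = encV u ∙ encV v ∙ encC c

  encEdges : List Edge → Tree
  encEdges E = encodeList (map encEdge E)

  -- M bounds the sizes of vertices, colours and slots, m the number of
  -- edges, and l the number of labels.
  module _ (M m l : ℕ) where

    eqCost compatibleCost claimCost bestCost : ℕ
    eqCost         = M * K
    compatibleCost = loopCost l (eqCost ∷ eqCost ∷ [])
    claimCost      = loopCost m (eqCost ∷ compatibleCost ∷ compatibleCost ∷ [])
    bestCost       = loopCost m (claimCost ∷ loopCost l [] ∷ [])

    Small : Edge → Set
    Small (u , v , c) = size (encV u) ≤ M × size (encV v) ≤ M × size (encC c) ≤ M

    eq-enc-call : ∀ {A : Set} {enc : A → Tree} → Injective _≡_ _≡_ enc → ∀ {x y} (x≟y : Dec (x ≡ y)) →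
      size (enc x) ≤ M → Call eqᶠ (enc x ∙ enc y) (bool (does x≟y)) eqCost
    eq-enc-call {enc = enc} inj {x} {y} x≟y x≤M =
      subst (λ b → Call eqᶠ (enc x ∙ enc y) (bool b) eqCost) (≡ᵗ-encoding inj x≟y)
        (relax (*-monoˡ-≤ K x≤M) (eq-call (enc x) (enc y)))

    compatible-loop : ∀ x j ls → size (encV x) ≤ M → size (encodeUnary j) ≤ M →
      Call compatibleᶠ (encLabels ls ∙ encV x ∙ encodeUnary j) (bool (does (compatible? x j ls)))
        (loopCost (length ls) (eqCost ∷ eqCost ∷ []))
    compatible-loop x j [] x≤M j≤M =
      returns (case-node! var! $ case-leaf! var! (cons! leaf! leaf!)) refl
        (loop-zero 0 (eqCost ∷ eqCost ∷ []))
    compatible-loop x j ((y , i) ∷ ls) x≤M j≤M =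
      returns
        (case-node! var! $ case-node! var! $
          letting! (call! (cons! var! var!) (compatible-loop x j ls x≤M j≤M)) $
          case-node! var! $ case-node! var! $
          if! (does (x ≟ⱽ y)) (call! (cons! var! var!) (eq-enc-call encV-injective (x ≟ⱽ y) x≤M)) var! $
          if! (does (j ≟ i))
            (call! (cons! var! var!) (eq-enc-call encodeUnary-injective (j ≟ i) j≤M)) leaf! var!)
        (value (does (x ≟ⱽ y)) (does (j ≟ i)) (does (compatible? x j ls)))
        (loop-suc (length ls) (eqCost ∷ eqCost ∷ []))
      where
      value : ∀ a b r → (if a then if b then bool r else leaf else bool r) ≡ bool ((not a ∨ b) ∧ r)
      value false b     r = refl
      value true  false r = refl
      value true  true  r = refl

    compatible-call : ∀ x j ls → size (encV x) ≤ M → size (encodeUnary j) ≤ M → length ls ≤ l →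
      Call compatibleᶠ (encLabels ls ∙ encV x ∙ encodeUnary j) (bool (does (compatible? x j ls)))
        compatibleCost
    compatible-call x j ls x≤M j≤M ls≤l =
      relax (loopCost-mono (eqCost ∷ eqCost ∷ []) ls≤l) (compatible-loop x j ls x≤M j≤M)

    claim-call : ∀ E c j ls → All Small E → size (encodeUnary j) ≤ M → length ls ≤ l →
      Call claimᶠ (encEdges E ∙ encC c ∙ encodeUnary j ∙ encLabels ls) (encLabels (claim j ls c E))
        (loopCost (length E) (eqCost ∷ compatibleCost ∷ compatibleCost ∷ []))
    claim-call [] c j ls [] j≤M ls≤l =
      returns (case-node! var! $ case-node! var! $ case-node! var! $ case-leaf! var! var!) refl
        (loop-zero 0 (eqCost ∷ compatibleCost ∷ compatibleCost ∷ []))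
    claim-call (e@(u , v , d) ∷ E) c j ls ((u≤M , v≤M , d≤M) ∷ small) j≤M ls≤l =
      returns
        (case-node! var! $ case-node! var! $ case-node! var! $
        case-node! var! $
          letting! (call! (cons! var! var!) (claim-call E c j ls small j≤M ls≤l)) $
          case-node! var! $ case-node! var! $
          if! (does (d ≟ᶜ c))
            (call! (cons! var! var!) (eq-enc-call encC-injective (d ≟ᶜ c) d≤M)) var! $
          if! (does (compatible? u j ls))
            (call! (cons! var! (cons! var! var!)) (compatible-call u j ls u≤M j≤M ls≤l)) var! $
          if! (does (compatible? v j ls))
            (call! (cons! var! (cons! var! var!)) (compatible-call v j ls v≤M j≤M ls≤l)) var!
            (cons! (cons! var! var!) (cons! (cons! var! var!) var!)))
        value
        (loop-suc (length E) (eqCost ∷ compatibleCost ∷ compatibleCost ∷ []))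
      where
      value : (if does (d ≟ᶜ c) then
                if does (compatible? u j ls) then
                  if does (compatible? v j ls) then encLabels (endLabels j e ++ claim j ls c E)
                  else encLabels (claim j ls c E)
                else encLabels (claim j ls c E)
              else encLabels (claim j ls c E))
            ≡ encLabels (claim j ls c (e ∷ E))
      value with does (d ≟ᶜ c) | does (compatible? u j ls) | does (compatible? v j ls)
      ... | false | _     | _     = refl
      ... | true  | false | _     = refl
      ... | true  | true  | false = refl
      ... | true  | true  | true  = refl

    module _ (E : List Edge) (small : All Small E) (E≤m : length E ≤ m) where

      -- The bound `l` has room for `2m` labels beyond `ls`, as `longerᶠ` runs along the list that
      -- results from a claim.
      best-loop : ∀ j ls F → size (encodeUnary j) ≤ M → m + m + length ls ≤ l →
        Call bestᶠ (encEdges F ∙ encEdges E ∙ encodeUnary j ∙ encLabels ls)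
          (encLabels (best E j ls F)) (loopCost (length F) (claimCost ∷ loopCost l [] ∷ []))
      best-loop j ls [] j≤M ls≤l =
        returns (case-node! var! $ case-node! var! $ case-leaf! var! $ case-node! var! var!) refl
          (loop-zero 0 (claimCost ∷ loopCost l [] ∷ []))
      best-loop j ls (e@(u , v , c) ∷ F) j≤M ls≤l =
        returns
          (case-node! var! $ case-node! var! $ case-node! var! $
            letting! (call! (cons! var! var!) (best-loop j ls F j≤M ls≤l)) $
            case-node! var! $ case-node! var! $
            letting! (call! (cons! var! (cons! var! var!))
              (relax (loopCost-mono (eqCost ∷ compatibleCost ∷ compatibleCost ∷ []) E≤m)
                (claim-call E c j ls small j≤M (≤-trans (m≤n+m _ _) ls≤l)))) $
            if! (length (claim j ls c E) ≤ᵇ length (best E j ls F))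
              (call! (cons! var! var!)
                (relax (loopCost-mono [] claim≤l)
                  (encodeList-longer encLabel (best E j ls F) (claim j ls c E))))
              var! var!)
          (value (length (claim j ls c E) ≤ᵇ length (best E j ls F)))
          (loop-suc (length F) (claimCost ∷ loopCost l [] ∷ []))
        where
        claim≤l : length (claim j ls c E) ≤ l
        claim≤l = ≤-trans (length-claim-≤ j ls c E)
          (≤-trans (+-monoˡ-≤ (length ls) (+-mono-≤ E≤m E≤m)) ls≤l)
        value : ∀ b → (if b then encLabels (best E j ls F) else encLabels (claim j ls c E))
                    ≡ encLabels (if b then best E j ls F else claim j ls c E)
        value false = refl
        value true  = refl

      greedy-call : ∀ j ls → size (encodeUnary j) ≤ M → j * (m + m) + length ls ≤ l →
        Call greedyᶠ (encodeUnary j ∙ encEdges E ∙ encLabels ls) (encLabels (greedy E j ls))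
          (loopCost j (bestCost ∷ []))
      greedy-call zero ls j≤M ls≤l =
        returns (case-node! var! $ case-node! var! $ case-leaf! var! var!) refl
          (loop-zero 0 (bestCost ∷ []))
      greedy-call (suc j) ls j≤M ls≤l =
        returns
          (case-node! var! $ case-node! var! $ case-node! var!
            (call! (cons! var! (cons! var!
              (call! (cons! var! (cons! var! (cons! var! var!)))
                (relax (loopCost-mono (claimCost ∷ loopCost l [] ∷ []) E≤m)
                  (best-loop (suc j) ls E j≤M
                    (≤-trans (+-monoˡ-≤ (length ls) (m≤m+n (m + m) _)) ls≤l))))))
              (greedy-call j (best E (suc j) ls E) (m+n≤o⇒n≤o 2 j≤M) next≤l)))
          refl
          -- The call of `bestᶠ` is an argument of the recursive call, so its cost comes first here,
          -- against the order in `loop-suc`.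
          (≤-trans (≤-reflexive (rearrange K bestCost (loopCost j (bestCost ∷ []))))
            (loop-suc j (bestCost ∷ [])))
        where
        rearrange : ∀ a b c → a + (b + (c + 0)) ≡ a + (c + (b + 0))
        rearrange = solve-∀
        next≤l : j * (m + m) + length (best E (suc j) ls E) ≤ l
        next≤l = begin
          j * (m + m) + length (best E (suc j) ls E)
            ≤⟨ +-monoʳ-≤ (j * (m + m)) (length-best-≤ E (suc j) ls E) ⟩
          j * (m + m) + (length E + length E + length ls)
            ≤⟨ +-monoʳ-≤ (j * (m + m)) (+-monoˡ-≤ (length ls) (+-mono-≤ E≤m E≤m)) ⟩
          j * (m + m) + (m + m + length ls)
            ≡⟨ shift (j * (m + m)) (m + m) (length ls) ⟩
          suc j * (m + m) + length ls
            ≤⟨ ls≤l ⟩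
          l ∎
          where
          open ≤-Reasoning
          shift : ∀ a b c → a + (b + c) ≡ b + a + c
          shift = solve-∀

      module _ (k : ℕ) (k≤M : size (encodeUnary k) ≤ M) (k≤l : k * (m + m) + (k + k) ≤ l) where

        greedyCost longerCost : ℕ
        greedyCost = loopCost k (bestCost ∷ [])
        longerCost = loopCost (k + k + (k + k)) []

        -- A node has at most `4k` labels to branch over, each with `k` slots.
        searchCost : ℕ → ℕ
        searchCost zero    = K + sum (greedyCost ∷ longerCost ∷ [])
        searchCost (suc d) = K + sum (greedyCost ∷ longerCost ∷
          loopCost (k + k + (k + k)) (loopCost k (searchCost d ∷ []) ∷ []) ∷ [])

        params : ℕ → List Label → Tree
        params d ls =
          encLabels ls ∙ encodeUnary d ∙ encodeUnary (length ls + (k + k)) ∙ encEdges E ∙ encodeUnary k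

        -- The parameters of a child before its label is put on: the threshold already counts that
        -- label, so consing the label gives `params` of the child by definition.
        childParams : ℕ → List Label → Tree
        childParams d ls =
          encLabels ls ∙ encodeUnary d ∙ encodeUnary (suc (length ls + (k + k))) ∙
          encEdges E ∙ encodeUnary k

        -- The induction hypothesis handed to the loops over labels and slots, which keeps the
        -- recursion structural in `d`.
        SearchCalls : ℕ → Set
        SearchCalls d = ∀ ls → length ls + d ≤ k + k →
          Call searchᶠ (params d ls) (bool (search E k d ls)) (searchCost d)

        if-bool : ∀ b c → (if b then leaf ∙ leaf else bool c) ≡ bool (b ∨ c)
        if-bool false c = refl
        if-bool true  c = refl

        slots-call : ∀ d ls x → SearchCalls d → length ls + suc d ≤ k + k → ∀ j →
          Call slotsᶠ (encodeUnary j ∙ encV x ∙ childParams d ls)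
            (bool (anySlot j (λ j → search E k d ((x , j) ∷ ls)))) (loopCost j (searchCost d ∷ []))
        slots-call d ls x calls fuel zero =
          returns (case-node! var! $ case-leaf! var! leaf!) refl (loop-zero 0 (searchCost d ∷ []))
        slots-call d ls x calls fuel (suc j) =
          returns
            (case-node! var! $ case-node! var! $
              letting! (call! (cons! var! var!) (slots-call d ls x calls fuel j)) $
              case-node! var! $ case-node! var! $
              if! (search E k d ((x , suc j) ∷ ls))
                (call! (cons! (cons! (cons! var! var!) var!) var!)
                  (calls ((x , suc j) ∷ ls) (≤-trans (≤-reflexive (sym (+-suc (length ls) d))) fuel)))
                var! (cons! leaf! leaf!))
            (if-bool (search E k d ((x , suc j) ∷ ls)) _)
            (loop-suc j (searchCost d ∷ []))

        branch-call : ∀ d ls → SearchCalls d → length ls + suc d ≤ k + k → ∀ ms →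
          Call branchᶠ (encLabels ms ∙ encodeUnary k ∙ childParams d ls)
            (bool (any (λ (x , _) → anySlot k (λ j → search E k d ((x , j) ∷ ls))) ms))
            (loopCost (length ms) (loopCost k (searchCost d ∷ []) ∷ []))
        branch-call d ls calls fuel [] =
          returns (case-node! var! $ case-leaf! var! leaf!) refl
            (loop-zero 0 (loopCost k (searchCost d ∷ []) ∷ []))
        branch-call d ls calls fuel ((x , i) ∷ ms) =
          returns
            (case-node! var! $ case-node! var! $
              letting! (call! (cons! var! var!) (branch-call d ls calls fuel ms)) $
              case-node! var! $ case-node! var! $
              if! (anySlot k (λ j → search E k d ((x , j) ∷ ls)))
                (call! (cons! var! (cons! var! var!)) (slots-call d ls x calls fuel k))
                var! (cons! leaf! leaf!))
            (if-bool (anySlot k (λ j → search E k d ((x , j) ∷ ls))) _)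
            (loop-suc (length ms) (loopCost k (searchCost d ∷ []) ∷ []))

        module _ {d : ℕ} {ls : List Label} (fuel : length ls + d ≤ k + k) where

          private
            ls≤2k : length ls ≤ k + k
            ls≤2k = ≤-trans (m≤m+n (length ls) d) fuel

          greedy-in-search : Call greedyᶠ (encodeUnary k ∙ encEdges E ∙ encLabels ls)
            (encLabels (greedy E k ls)) greedyCost
          greedy-in-search = greedy-call k ls k≤M (≤-trans (+-monoʳ-≤ (k * (m + m)) ls≤2k) k≤l)

          longer-in-search : Call longerᶠ (encLabels (greedy E k ls) ∙ encodeUnary (length ls + (k + k)))
            (bool (length ls + (k + k) ≤ᵇ length (greedy E k ls))) longerCost
          longer-in-search = relax (loopCost-mono [] (+-monoˡ-≤ (k + k) ls≤2k))
            (encodeUnary-longer encLabel (greedy E k ls) (length ls + (k + k)))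

        -- The outcome of the test is split instead of using `if!`, since only its failure bounds
        -- the number of labels to branch over, by `length ls + 2k` and so by `4k`.
        search-call : ∀ d → SearchCalls d
        search-call d ls fuel
          with length ls + (k + k) ≤ᵇ length (greedy E k ls)
             | ≤ᵇ-reflects-≤ (length ls + (k + k)) (length (greedy E k ls))
             | longer-in-search {d} {ls} fuel
        search-call zero ls fuel | true | _ | longer′ =
          returns
            (case-node! var! $ case-node! var! $ case-node! var! $ case-node! var! $
              letting! (call! (cons! var! (cons! var! var!)) (greedy-in-search fuel)) $
              case-node! (call! (cons! var! var!) longer′) (cons! leaf! leaf!))
            refl ≤-refl
        search-call (suc d) ls fuel | true | _ | longer′ =
          returns
            (case-node! var! $ case-node! var! $ case-node! var! $ case-node! var! $
              letting! (call! (cons! var! (cons! var! var!)) (greedy-in-search fuel)) $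
              case-node! (call! (cons! var! var!) longer′) (cons! leaf! leaf!))
            refl (+-monoʳ-≤ K (+-monoʳ-≤ greedyCost (+-monoʳ-≤ longerCost z≤n)))
        search-call zero ls fuel | false | _ | longer′ =
          returns
            (case-node! var! $ case-node! var! $ case-node! var! $ case-node! var! $
              letting! (call! (cons! var! (cons! var! var!)) (greedy-in-search fuel)) $
              case-leaf! (call! (cons! var! var!) longer′) $ case-leaf! var! leaf!)
            refl ≤-refl
        search-call (suc d) ls fuel | false | ofⁿ short | longer′ =
          returns
            (case-node! var! $ case-node! var! $ case-node! var! $ case-node! var! $
              letting! (call! (cons! var! (cons! var! var!)) (greedy-in-search fuel)) $
              case-leaf! (call! (cons! var! var!) longer′) $
                case-node! var!
                  (call!
                    (cons! var! (cons! var! (cons! var! (cons! var! (cons! (cons! leaf! var!) var!)))))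
                    (relax (loopCost-mono (loopCost k (searchCost d ∷ []) ∷ [])
                      (≤-trans (<⇒≤ (≰⇒> short))
                        (+-monoˡ-≤ (k + k) (≤-trans (m≤m+n (length ls) (suc d)) fuel))))
                      (branch-call d ls (search-call d) fuel (greedy E k ls)))))
            refl ≤-refl

-- The total cost

sum-≤ : ∀ {b ts} → All (_≤ b) ts → sum ts ≤ length ts * b
sum-≤ []       = z≤n
sum-≤ (p ∷ ps) = +-mono-≤ p (sum-≤ ps)

^-distribʳ-* : ∀ n x y → (x * y) ^ n ≡ x ^ n * y ^ n
^-distribʳ-* zero    x y = refl
^-distribʳ-* (suc n) x y =
  trans (cong (x * y *_) (^-distribʳ-* n x y)) (interchange x y (x ^ n) (y ^ n))
  where
  interchange : ∀ a b c d → a * b * (c * d) ≡ a * c * (b * d)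
  interchange = solve-∀

1≤K : 1 ≤ K
1≤K = ≤ᵇ100⇒≤K tt

module PowerBounds (X : ℕ) (K≤X : K ≤ X) where

  instance
    X-nonZero : NonZero X
    X-nonZero = >-nonZero (≤-trans 1≤K K≤X)

  raise : ∀ {e f} → e ≤ f → X ^ e ≤ X ^ f
  raise = ^-monoʳ-≤ X

  base≤power : ∀ e → X ≤ X ^ suc e
  base≤power e = ≤-trans (≤-reflexive (sym (^-identityʳ X))) (raise {1} {suc e} (s≤s z≤n))

  few-terms : ∀ {c b ts} → suc (length ts) ≤ c → c ≤ K → K ≤ b → All (_≤ b) ts → K + sum ts ≤ X * b
  few-terms {c} {b} {ts} few c≤K K≤b ts≤b = begin
    K + sum ts            ≤⟨ +-mono-≤ K≤b (sum-≤ ts≤b) ⟩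
    suc (length ts) * b   ≤⟨ *-monoˡ-≤ b (≤-trans few (≤-trans c≤K K≤X)) ⟩
    X * b                 ∎
    where open ≤-Reasoning

  -- One factor `X` pays for the number of rounds, another for the number of summands in a round;
  -- each level of nesting thus adds two to the exponent.
  loopCost-≤ : ∀ {n ts} e {_ : T (suc (length ts) ≤ᵇ 100)} → suc n ≤ X → All (_≤ X ^ suc e) ts →
    loopCost n ts ≤ X ^ (3 + e)
  loopCost-≤ {n} {ts} e {few} n<X ts≤ =
    *-mono-≤ n<X (few-terms {suc (length ts)} ≤-refl (≤ᵇ100⇒≤K {suc (length ts)} few)
      (≤-trans K≤X (base≤power e)) ts≤)

module _ {V C : Set} (_≟ⱽ_ : DecidableEquality V) (_≟ᶜ_ : DecidableEquality C)
  (encV : V → Tree) (encV-injective : Injective _≡_ _≡_ encV)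
  (encC : C → Tree) (encC-injective : Injective _≡_ _≡_ encC) where

  open Algorithm _≟ⱽ_ _≟ᶜ_
  open Execution _≟ⱽ_ _≟ᶜ_ encV encV-injective encC encC-injective

  module _ (E : List Edge) (N k : ℕ) (E<N : length E < N)
    (edge≤N : All (λ (u , v , c) → size (encV u) ≤ N × size (encV v) ≤ N × size (encC c) ≤ N) E) where

    private
      -- `Y` bounds the sizes of vertices, colours and slots as well as the lengths of label lists.
      -- The factor `K` in `X` absorbs constant multiples of `Q`, and `a` is the part of `X` free of
      -- `N`.
      Q a X Y : ℕ
      Q = suc k * N
      a = K * suc k
      X = a * N
      Y = 4 * Q

      1≤N : 1 ≤ N
      1≤N = ≤-trans (s≤s z≤n) E<N

      k<Q : suc k ≤ Q
      k<Q = ≤-trans (≤-reflexive (sym (*-identityʳ (suc k)))) (*-monoʳ-≤ (suc k) 1≤N)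

      N≤Q : N ≤ Q
      N≤Q = m≤m+n N (k * N)

      c*Q≤X : ∀ c {_ : T (c ≤ᵇ 100)} → c * Q ≤ X
      c*Q≤X c {p} = ≤-trans (*-monoˡ-≤ Q (≤ᵇ100⇒≤K {c} p)) (≤-reflexive (sym (*-assoc K (suc k) N)))

      Q≤X : Q ≤ X
      Q≤X = ≤-trans (≤-reflexive (sym (*-identityˡ Q))) (c*Q≤X 1)

      K≤X : K ≤ X
      K≤X = ≤-trans (≤-reflexive (sym (*-identityʳ K)))
        (≤-trans (*-monoʳ-≤ K (≤-trans (s≤s z≤n) k<Q)) (≤-reflexive (sym (*-assoc K (suc k) N))))

      Y<X : suc Y ≤ X
      Y<X = ≤-trans (+-monoˡ-≤ Y (≤-trans (s≤s z≤n) k<Q)) (c*Q≤X 5)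

      N<X : suc N ≤ X
      N<X = ≤-trans (+-mono-≤ (≤-trans (s≤s z≤n) k<Q) N≤Q)
        (≤-trans (≤-reflexive (cong (Q +_) (sym (+-identityʳ Q)))) (c*Q≤X 2))

      k<X : suc k ≤ X
      k<X = ≤-trans k<Q Q≤X

      4k+1≤4[k+1] : suc (k + k + (k + k)) ≤ 4 * suc k
      4k+1≤4[k+1] = ≤-trans (m≤m+n _ 3) (≤-reflexive (rearrange k))
        where
        rearrange : ∀ k → suc (k + k + (k + k)) + 3 ≡ 4 * suc k
        rearrange = solve-∀

      4k<X : suc (k + k + (k + k)) ≤ X
      4k<X = ≤-trans 4k+1≤4[k+1] (≤-trans (*-monoʳ-≤ 4 k<Q) (c*Q≤X 4))

      small : All (Small Y N Y) E
      small = All.map (λ (p , q , r) → N≤Y p , N≤Y q , N≤Y r) edge≤N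
        where
        N≤Y : ∀ {s} → s ≤ N → s ≤ Y
        N≤Y s≤N = ≤-trans s≤N (≤-trans N≤Q (m≤m+n Q _))

      k≤Y : size (encodeUnary k) ≤ Y
      k≤Y = begin
        size (encodeUnary k) ≡⟨ size-encodeUnary k ⟩
        suc (k + k)          ≤⟨ s≤s (m≤m+n (k + k) (k + k)) ⟩
        suc (k + k + (k + k)) ≤⟨ 4k+1≤4[k+1] ⟩
        4 * suc k            ≤⟨ *-monoʳ-≤ 4 k<Q ⟩
        Y                    ∎
        where open ≤-Reasoning

      labels≤Y : k * (N + N) + (k + k) ≤ Y
      labels≤Y = begin
        k * (N + N) + (k + k)       ≡⟨ rearrange k N ⟩
        2 * (k * N) + 2 * k         ≤⟨ +-mono-≤ (*-monoʳ-≤ 2 (m≤n+m (k * N) N))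
                                         (*-monoʳ-≤ 2 (≤-trans (n≤1+n k) k<Q)) ⟩
        2 * Q + 2 * Q               ≡⟨ *-distribʳ-+ Q 2 2 ⟨
        Y                           ∎
        where
        open ≤-Reasoning
        rearrange : ∀ k N → k * (N + N) + (k + k) ≡ 2 * (k * N) + 2 * k
        rearrange = solve-∀

      open PowerBounds X K≤X

      greedy≤ : greedyCost Y N Y E small (<⇒≤ E<N) k k≤Y labels≤Y ≤ X ^ 10
      greedy≤ = loopCost-≤ 7 k<X (best≤ ∷ [])
        where
        eq≤ : eqCost Y N Y ≤ X ^ 2
        eq≤ = *-mono-≤ (<⇒≤ Y<X) (≤-trans K≤X (base≤power 0))
        compatible≤ : compatibleCost Y N Y ≤ X ^ 4
        compatible≤ = loopCost-≤ 1 Y<X (eq≤ ∷ eq≤ ∷ [])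
        claim≤ : claimCost Y N Y ≤ X ^ 6
        claim≤ = loopCost-≤ 3 N<X
          (≤-trans eq≤ (raise {2} {4} (s≤s (s≤s z≤n))) ∷ compatible≤ ∷ compatible≤ ∷ [])
        best≤ : bestCost Y N Y ≤ X ^ 8
        best≤ = loopCost-≤ 5 N<X
          (claim≤ ∷ ≤-trans (loopCost-≤ 0 Y<X []) (raise {3} {6} (≤ᵇ⇒≤ 3 6 tt)) ∷ [])

      cost : ℕ → ℕ
      cost = searchCost Y N Y E small (<⇒≤ E<N) k k≤Y labels≤Y

      -- `N` enters only through `X ^ 11`; a level of the search tree contributes `a * a`, which
      -- depends on `k` alone.
      bound : ℕ → ℕ
      bound d = X ^ 11 * (a * a) ^ d

      instance
        a-nonZero : NonZero a
        a-nonZero = m*n≢0 K (suc k) {{>-nonZero 1≤K}}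

        aa-nonZero : NonZero (a * a)
        aa-nonZero = m*n≢0 a a

      X¹¹≤bound : ∀ d → X ^ 11 ≤ bound d
      X¹¹≤bound d = m≤m*n (X ^ 11) ((a * a) ^ d) {{m^n≢0 (a * a) d}}

      K≤bound : ∀ d → K ≤ bound d
      K≤bound d = ≤-trans (≤-trans K≤X (base≤power 10)) (X¹¹≤bound d)

      greedy≤bound : ∀ d → greedyCost Y N Y E small (<⇒≤ E<N) k k≤Y labels≤Y ≤ bound d
      greedy≤bound d = ≤-trans greedy≤ (≤-trans (raise {10} {11} (n≤1+n 10)) (X¹¹≤bound d))

      longer≤X³ : loopCost (k + k + (k + k)) [] ≤ X ^ 3
      longer≤X³ = loopCost-≤ 0 4k<X []

      X³≤bound : ∀ d → X ^ 3 ≤ bound d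
      X³≤bound d = ≤-trans (raise {3} {11} (≤ᵇ⇒≤ 3 11 tt)) (X¹¹≤bound d)

      cost≤bound : ∀ d → cost d ≤ bound d
      cost≤bound zero = ≤-trans
        (few-terms {3} ≤-refl (≤ᵇ100⇒≤K {3} tt) (≤-trans K≤X (base≤power 9))
          (greedy≤ ∷ ≤-trans longer≤X³ (raise {3} {10} (≤ᵇ⇒≤ 3 10 tt)) ∷ []))
        (≤-reflexive (sym (*-identityʳ (X ^ 11))))
      cost≤bound (suc d) = begin
        K + (greedyCost Y N Y E small (<⇒≤ E<N) k k≤Y labels≤Y + (loopCost (k + k + (k + k)) [] +
          (suc (k + k + (k + k)) * (K + (s * (K + (cost d + 0)) + 0)) + 0)))
          ≤⟨ +-mono-≤ (K≤bound d) (+-mono-≤ (greedy≤bound d) (+-mono-≤ (≤-trans longer≤X³ (X³≤bound d))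
               (+-monoˡ-≤ 0 (*-mono-≤ 4k+1≤4[k+1] (+-mono-≤ (K≤bound d)
                 (+-monoˡ-≤ 0 (*-monoʳ-≤ s (+-mono-≤ (K≤bound d) (+-monoˡ-≤ 0 (cost≤bound d)))))))))) ⟩
        b + (b + (b + (4 * s * (b + (s * (b + (b + 0)) + 0)) + 0)))
          -- With `s = k + 1` the sum is `(8s² + 4s + 3) b`, which falls short of `15 s² b` by
          -- `(7k² + 10k) b`.
          ≤⟨ ≤-trans (m≤m+n _ ((7 * (k * k) + 10 * k) * b)) (≤-reflexive (rearrange k b)) ⟩
        15 * b * (s * s)
          ≤⟨ *-monoˡ-≤ (s * s) (*-monoˡ-≤ b (≤-trans (≤ᵇ100⇒≤K {15} tt) (m≤m*n K K {{>-nonZero 1≤K}}))) ⟩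
        K * K * b * (s * s)
          ≡⟨ regroup K b s ⟩
        a * a * b
          ≡⟨ swap (a * a) (X ^ 11) ((a * a) ^ d) ⟩
        bound (suc d) ∎
        where
        open ≤-Reasoning
        b = bound d
        s = suc k
        rearrange : ∀ k b →
          b + (b + (b + (4 * suc k * (b + (suc k * (b + (b + 0)) + 0)) + 0))) +
            ((7 * (k * k) + 10 * k) * b) ≡ 15 * b * (suc k * suc k)
        rearrange = solve-∀
        regroup : ∀ K b s → K * K * b * (s * s) ≡ K * s * (K * s) * b
        regroup = solve-∀
        swap : ∀ x y z → x * (y * z) ≡ y * (x * z)
        swap = solve-∀

      -- Doubling `k` twice and the main body cost one more factor `X`; splitting `X ^ 12` into
      -- powers of `a` and `N` then separates the parameter from the input size.
      search-cost : K + sum (loopCost k [] ∷ loopCost k [] ∷ cost (k + k) ∷ []) ≤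
        a ^ 12 * (a * a) ^ (k + k) * N ^ 12
      search-cost = begin
        K + sum (loopCost k [] ∷ loopCost k [] ∷ cost (k + k) ∷ [])
          ≤⟨ few-terms {4} ≤-refl (≤ᵇ100⇒≤K {4} tt) (K≤bound (k + k))
               (double≤ ∷ double≤ ∷ cost≤bound (k + k) ∷ []) ⟩
        X * (X ^ 11 * (a * a) ^ (k + k))
          ≡⟨ *-assoc X (X ^ 11) ((a * a) ^ (k + k)) ⟨
        X ^ 12 * (a * a) ^ (k + k)
          ≡⟨ cong (_* (a * a) ^ (k + k)) (^-distribʳ-* 12 a N) ⟩
        a ^ 12 * N ^ 12 * (a * a) ^ (k + k)
          ≡⟨ swap (a ^ 12) (N ^ 12) ((a * a) ^ (k + k)) ⟩
        a ^ 12 * (a * a) ^ (k + k) * N ^ 12 ∎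
        where
        open ≤-Reasoning
        swap : ∀ x y z → x * y * z ≡ x * z * y
        swap = solve-∀
        double≤ : loopCost k [] ≤ bound (k + k)
        double≤ = ≤-trans (loopCost-≤ 0 k<X []) (X³≤bound (k + k))

    main-run : ∀ x y → ∃[ t ]
      (bodies ∣ ((x ∙ y ∙ encEdges E) ∙ encodeUnary k) ∷ []
        ⊢ mainBody ⇓ bool (search E k (k + k) []) ⟨ t ⟩) ×
      t ≤ (K * suc k) ^ 12 * (K * suc k * (K * suc k)) ^ (k + k) * N ^ 12
    main-run x y = within
      (case-node! var! $ case-node! var! $ case-node! var! $
        call! (cons! leaf! $ cons! (call! var! (double-call k)) $ cons! (call! var! (double-call k)) $
          cons! var! var!)
          (search-call Y N Y E small (<⇒≤ E<N) k k≤Y labels≤Y (k + k) [] ≤-refl))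
      search-cost
      where
      within : ∀ {n} {ρ : Vec Tree n} {e v c ts b} → Run ρ e v c ts → {T (c ≤ᵇ 100)} → K + sum ts ≤ b →
        ∃[ t ] (bodies ∣ ρ ⊢ e ⇓ v ⟨ t ⟩) × t ≤ b
      within (run p q) {c≤} le = _ , p , ≤-trans q (≤-trans (+-monoˡ-≤ _ (≤ᵇ100⇒≤K c≤)) le)

-- The parameter dependence

infix 3 _∣_⊢_↓_

-- `Computable` accepts any step count, so for this program only termination with the right value is
-- tracked.
_∣_⊢_↓_ : ∀ {m n} → Vec (Exp m 1) m → Vec Tree n → Exp m n → Tree → Set
fs ∣ ρ ⊢ e ↓ v = ∃[ t ] (fs ∣ ρ ⊢ e ⇓ v ⟨ t ⟩)

pattern addᶠ = 0F
pattern mulᶠ = 1F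
pattern powᶠ = 2F

addBody mulBody powBody parameterBody : Exp 3 1

addBody = split v0 (case v0 v1 (leaf ⋆ call addᶠ (v1 ⋆ v3)))

mulBody = split v0 (case v0 leaf (call addᶠ (v3 ⋆ call mulᶠ (v1 ⋆ v3))))

powBody = split v0 (case v0 (leaf ⋆ leaf) (call mulᶠ (v3 ⋆ call powᶠ (v1 ⋆ v3))))

numeral : ∀ {m n} → ℕ → Exp m n
numeral zero    = leaf
numeral (suc i) = leaf ⋆ numeral i

parameterBody =
  letting (call mulᶠ (numeral K ⋆ leaf ⋆ v0))
  (call mulᶠ (call powᶠ (numeral 12 ⋆ v0) ⋆ call powᶠ (call addᶠ (v1 ⋆ v1) ⋆ call mulᶠ (v0 ⋆ v0))))

parameterFunction : ℕ → ℕ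
parameterFunction k = (K * suc k) ^ 12 * (K * suc k * (K * suc k)) ^ (k + k)

parameterFunction-computable : Computable parameterFunction
parameterFunction-computable =
  program arith parameterBody , λ k → _ , _ , proj₂ (runs k) , ≤-refl
  where
  arith : Vec (Exp 3 1) 3
  arith = addBody ∷ mulBody ∷ powBody ∷ []

  numeral-⇓ : ∀ {n} {ρ : Vec Tree n} i → arith ∣ ρ ⊢ numeral i ↓ encodeUnary i
  numeral-⇓ zero    = _ , ⇓leaf
  numeral-⇓ (suc i) = _ , ⇓cons ⇓leaf (proj₂ (numeral-⇓ i))

  add-⇓ : ∀ x y → arith ∣ (encodeUnary x ∙ encodeUnary y) ∷ [] ⊢ addBody ↓ encodeUnary (x + y)
  add-⇓ zero    y = _ , ⇓case-node ⇓var (⇓case-leaf ⇓var ⇓var)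
  add-⇓ (suc x) y = _ , ⇓case-node ⇓var (⇓case-node ⇓var
    (⇓cons ⇓leaf (⇓call (⇓cons ⇓var ⇓var) (proj₂ (add-⇓ x y)))))

  mul-⇓ : ∀ x y → arith ∣ (encodeUnary x ∙ encodeUnary y) ∷ [] ⊢ mulBody ↓ encodeUnary (x * y)
  mul-⇓ zero    y = _ , ⇓case-node ⇓var (⇓case-leaf ⇓var ⇓leaf)
  mul-⇓ (suc x) y = _ , ⇓case-node ⇓var (⇓case-node ⇓var
    (⇓call (⇓cons ⇓var (⇓call (⇓cons ⇓var ⇓var) (proj₂ (mul-⇓ x y)))) (proj₂ (add-⇓ y (x * y)))))

  pow-⇓ : ∀ x y → arith ∣ (encodeUnary x ∙ encodeUnary y) ∷ [] ⊢ powBody ↓ encodeUnary (y ^ x)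
  pow-⇓ zero    y = _ , ⇓case-node ⇓var (⇓case-leaf ⇓var (⇓cons ⇓leaf ⇓leaf))
  pow-⇓ (suc x) y = _ , ⇓case-node ⇓var (⇓case-node ⇓var
    (⇓call (⇓cons ⇓var (⇓call (⇓cons ⇓var ⇓var) (proj₂ (pow-⇓ x y)))) (proj₂ (mul-⇓ y (y ^ x)))))

  runs : ∀ k → arith ∣ encodeUnary k ∷ [] ⊢ parameterBody ↓ encodeUnary (parameterFunction k)
  runs k = _ , ⇓letting (⇓call (⇓cons (proj₂ (numeral-⇓ K)) (⇓cons ⇓leaf ⇓var)) (proj₂ (mul-⇓ K (suc k))))
    (⇓call
      (⇓cons
        (⇓call (⇓cons (proj₂ (numeral-⇓ 12)) ⇓var) (proj₂ (pow-⇓ 12 a)))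
        (⇓call (⇓cons (⇓call (⇓cons ⇓var ⇓var) (proj₂ (add-⇓ k k)))
                      (⇓call (⇓cons ⇓var ⇓var) (proj₂ (mul-⇓ a a))))
          (proj₂ (pow-⇓ (k + k) (a * a)))))
      (proj₂ (mul-⇓ (a ^ 12) ((a * a) ^ (k + k)))))
    where
    a = K * suc k

-- Application to encoded edge-coloured graphs

module _ (G : EdgeColouredGraph) where

  open EdgeColouredGraph G

  private
    vertex : Fin n → Tree
    vertex v = encodeBinary (toℕ v)

    colourTree : Fin t → Tree
    colourTree c = encodeBinary (suc (toℕ c))

    vertex-injective : Injective _≡_ _≡_ vertex
    vertex-injective = Fin.toℕ-injective ∘ encodeBinary-injective

    colourTree-injective : Injective _≡_ _≡_ colourTree
    colourTree-injective = Fin.toℕ-injective ∘ suc-injective ∘ encodeBinary-injective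

  open Algorithm {Fin n} {Fin t} Fin._≟_ Fin._≟_ using (Edge; search; search-correct)
  open Execution {Fin n} {Fin t} Fin._≟_ Fin._≟_ vertex vertex-injective colourTree colourTree-injective
    using (encEdge; encEdges)

  private
    N : ℕ
    N = size (encodeGraph G)

    encEdges≤N : size (encEdges edges) ≤ N
    encEdges≤N = ≤-trans (m≤n+m _ (size (encodeBinary t)))
      (≤-trans (n≤1+n _) (≤-trans (m≤n+m _ _) (n≤1+n _)))

    length<size : ∀ (F : List Edge) → length F < size (encEdges F)
    length<size []      = s≤s z≤n
    length<size (e ∷ F) = s≤s (≤-trans (length<size F) (m≤n+m _ (size (encEdge e))))

    edges-small : ∀ F → size (encEdges F) ≤ N →
      All (λ (u , v , c) → size (vertex u) ≤ N × size (vertex v) ≤ N × size (colourTree c) ≤ N) F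
    edges-small []                F≤N = []
    edges-small ((u , v , c) ∷ F) F≤N =
      ( below (m≤m+n _ _)
      , below (≤-trans (≤-trans (m≤m+n _ _) (n≤1+n _)) (m≤n+m _ (size (vertex u))))
      , below (≤-trans (≤-trans (m≤n+m _ (size (vertex v))) (n≤1+n _)) (m≤n+m _ (size (vertex u)))))
      ∷ edges-small F (≤-trans (≤-trans (m≤n+m _ _) (n≤1+n _)) F≤N)
      where
      below : ∀ {s} → s ≤ size (vertex u) + size (vertex v ∙ colourTree c) → s ≤ N
      below s≤ = ≤-trans s≤ (≤-trans (n≤1+n _) (≤-trans (m≤m+n _ _) (≤-trans (n≤1+n _) F≤N)))

  clustering-run : ∀ k → program bodies mainBody on (encodeGraph G ∙ encodeUnary k)
    yields bool (search edges k (k + k) []) within (parameterFunction k * N ^ 12)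
  clustering-run k =
    main-run Fin._≟_ Fin._≟_ vertex vertex-injective colourTree colourTree-injective
      edges N k (≤-trans (length<size edges) encEdges≤N) (edges-small edges encEdges≤N)
      _ _

  clustering-correct : ∀ k → bool (search edges k (k + k) []) ≢ leaf ⇔
    ParameterizedProblem.Yes ColouredClustering G k
  -- A positive number of colours provides a constant colouring for soundness to start from.
  clustering-correct k with search edges k (k + k) [] | search-correct edges k (λ _ → fromℕ< t-positive)
  ... | true  | correct = mk⇔ (λ _ → Equivalence.to correct refl) (λ _ ())
  ... | false | correct = mk⇔ (λ leaf≢leaf → contradiction refl leaf≢leaf)
    (λ yes → contradiction (Equivalence.from correct yes) λ ())

theorem6p2 : FixedParameterTractable ColouredClustering
theorem6p2 =
  program bodies mainBody , parameterFunction , 12 , parameterFunction-computable ,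
  λ G k _ → bool (search G k) , clustering-run G k , clustering-correct G k
  where
  search : EdgeColouredGraph → ℕ → Bool
  search G k = Algorithm.search Fin._≟_ Fin._≟_ (EdgeColouredGraph.edges G) k (k + k) []
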